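{- There exists an absolute constant $C>0$ such that the following holds. Let $R$ be a ring, and let $A \subset R^*$ be a finite non-empty set of non-zero-divisors such that $|A+A| \leq K|A|$ and $|A \cdot A| \leq K|A|$ for some $K \geq 1$. Then one of the following holds: (i) ($A-A$ has many zero divisors) $|(A-A) \setminus R^*| \geq C^{ -1} K^{ -C} |A|$; (ii) (Existence of good subset) there exists a subset $A'$ of $A$ such that $|A'| \geq |A|/(2K)$ and $|A' \cdot A' - A' \cdot A'| = O(K^{O(1)} |A'|)$.
   Context: Rings are associative, but need not be commutative and need not contain a multiplicative identity. For subsets $A,B$ of a ring $R$: $A+B := \{a+b : a\in A, b\in B\}$, $A-B := \{a-b : a \in A, b\in B\}$, $A\cdot B := \{ab : a\in A, b\in B\}$. $|A|$ denotes the cardinality of a finite set $A$. $R^*$ denotes the set of non-zero-divisors of $R$, i.e. the elements $r \in R$ such that $ra \neq 0$ and $ar \neq 0$ whenever $a \in R$, $a \neq 0$. The notation $X = O(K^{O(1)} Y)$ means $X \leq C_1 K^{C_2} Y$ for some absolute constants $C_1, C_2 > 0$. -}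

module Defs where

open import Level using (Level; Setω; _⊔_)
open import Algebra.Bundles using (RingWithoutOne)
open import Axiom.ExcludedMiddle using (ExcludedMiddle)
open import Data.List.Base using (List; length; filter; deduplicate; cartesianProductWith)
open import Data.Nat.Base as ℕ using (ℕ; zero; suc)
import Data.Nat.Properties as ℕ
open import Data.Integer.Base using (+_)
open import Data.Product using (_×_; _,_; ∃-syntax)
open import Data.Rational.Base as ℚ using (ℚ; 0ℚ; 1ℚ; ½; _/_)
import Data.Rational.Properties as ℚ
open import Relation.Binary.PropositionalEquality using (_≡_; sym; trans; cong; cong₂; module ≡-Reasoning)
open import Relation.Nullary using (¬_)
open import Relation.Nullary.Decidable using (¬?)
open import Relation.Unary using (Pred)

IsCauchy : (ℕ → ℚ) → Set
IsCauchy x = ∀ ε → 0ℚ ℚ.< ε → ∃[ N ] (∀ m n → N ℕ.≤ m → N ℕ.≤ n →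
             ℚ.∣ x m ℚ.- x n ∣ ℚ.≤ ε)

-- Real numbers as Cauchy sequences of rationals.  Equality of reals is
-- x ≤ᴿ y together with y ≤ᴿ x, not propositional equality.
record ℝ : Set where
  constructor mkℝ
  field
    seq    : ℕ → ℚ
    cauchy : IsCauchy seq
open ℝ public

infix  4 _≤ᴿ_
infixl 7 _*ᴿ_
infixr 8 _^ᴿ_

_≤ᴿ_ : ℝ → ℝ → Set
x ≤ᴿ y = ∀ ε → 0ℚ ℚ.< ε → ∃[ N ] (∀ n → N ℕ.≤ n → seq x n ℚ.≤ seq y n ℚ.+ ε)

fromℚ : ℚ → ℝ
fromℚ q = mkℝ (λ _ → q) λ ε 0<ε → 0 , λ _ _ _ _ →
  ℚ.≤-trans (ℚ.≤-reflexive (cong ℚ.∣_∣ (ℚ.+-inverseʳ q))) (ℚ.<⇒≤ 0<ε)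

fromℕ : ℕ → ℝ
fromℕ n = fromℚ (+ n / 1)

private
  a≡[a-b]+b : ∀ a b → a ≡ (a ℚ.- b) ℚ.+ b
  a≡[a-b]+b a b = sym (trans (ℚ.+-assoc a (ℚ.- b) b)
    (trans (cong (a ℚ.+_) (ℚ.+-inverseˡ b)) (ℚ.+-identityʳ a)))

  ab-cd : ∀ a b c d → a ℚ.* b ℚ.- c ℚ.* d ≡ a ℚ.* (b ℚ.- d) ℚ.+ d ℚ.* (a ℚ.- c)
  ab-cd a b c d = begin
    a ℚ.* b ℚ.- c ℚ.* d
      ≡⟨ cong (ℚ._- (c ℚ.* d)) (a≡[a-b]+b (a ℚ.* b) (a ℚ.* d)) ⟩
    (a ℚ.* b ℚ.- a ℚ.* d) ℚ.+ a ℚ.* d ℚ.- c ℚ.* d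
      ≡⟨ ℚ.+-assoc (a ℚ.* b ℚ.- a ℚ.* d) (a ℚ.* d) (ℚ.- (c ℚ.* d)) ⟩
    (a ℚ.* b ℚ.- a ℚ.* d) ℚ.+ (a ℚ.* d ℚ.- c ℚ.* d)
      ≡⟨ cong₂ (λ p q → (a ℚ.* b ℚ.- a ℚ.* d) ℚ.+ (p ℚ.- q)) (ℚ.*-comm a d) (ℚ.*-comm c d) ⟩
    (a ℚ.* b ℚ.- a ℚ.* d) ℚ.+ (d ℚ.* a ℚ.- d ℚ.* c)
      ≡⟨ cong₂ ℚ._+_ (factor a b d) (factor d a c) ⟩
    a ℚ.* (b ℚ.- d) ℚ.+ d ℚ.* (a ℚ.- c) ∎
    where
    open ≡-Reasoning
    factor : ∀ p q r → p ℚ.* q ℚ.- p ℚ.* r ≡ p ℚ.* (q ℚ.- r)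
    factor p q r = sym (trans (ℚ.*-distribˡ-+ p q (ℚ.- r))
      (cong (p ℚ.* q ℚ.+_) (sym (ℚ.neg-distribʳ-* p r))))

  eventuallyBounded : ∀ {x} → IsCauchy x →
    ∃[ B ] (ℚ.Positive B × ∃[ N ] (∀ n → N ℕ.≤ n → ℚ.∣ x n ∣ ℚ.≤ B))
  eventuallyBounded {x} cx with cx 1ℚ (ℚ.positive⁻¹ 1ℚ)
  ... | N , close = 1ℚ ℚ.+ ℚ.∣ x N ∣ , B>0 , N , bound
    where
    B>0 : ℚ.Positive (1ℚ ℚ.+ ℚ.∣ x N ∣)
    B>0 = ℚ.positive (ℚ.+-mono-<-≤ (ℚ.positive⁻¹ 1ℚ) (ℚ.0≤∣p∣ (x N)))

    bound : ∀ n → N ℕ.≤ n → ℚ.∣ x n ∣ ℚ.≤ 1ℚ ℚ.+ ℚ.∣ x N ∣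
    bound n N≤n = begin
      ℚ.∣ x n ∣                          ≡⟨ cong ℚ.∣_∣ (a≡[a-b]+b (x n) (x N)) ⟩
      ℚ.∣ (x n ℚ.- x N) ℚ.+ x N ∣        ≤⟨ ℚ.∣p+q∣≤∣p∣+∣q∣ (x n ℚ.- x N) (x N) ⟩
      ℚ.∣ x n ℚ.- x N ∣ ℚ.+ ℚ.∣ x N ∣    ≤⟨ ℚ.+-monoˡ-≤ ℚ.∣ x N ∣ (close n N N≤n ℕ.≤-refl) ⟩
      1ℚ ℚ.+ ℚ.∣ x N ∣                   ∎
      where open ℚ.≤-Reasoning

  scale : ∀ B .{{_ : ℚ.Positive B}} ε → 0ℚ ℚ.< ε →
          ∃[ δ ] (0ℚ ℚ.< δ × B ℚ.* δ ≡ ½ ℚ.* ε)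
  scale B ε 0<ε = δ , ℚ.positive⁻¹ δ , eq
    where
    instance
      B≢0 : ℚ.NonZero B
      B≢0 = ℚ.pos⇒nonZero B
      B⁻¹>0 : ℚ.Positive (ℚ.1/ B)
      B⁻¹>0 = ℚ.1/pos⇒pos B
      ε>0 : ℚ.Positive ε
      ε>0 = ℚ.positive 0<ε
      h>0 : ℚ.Positive (½ ℚ.* ε)
      h>0 = ℚ.pos*pos⇒pos ½ ε
    δ : ℚ
    δ = ℚ.1/ B ℚ.* (½ ℚ.* ε)
    instance
      δ>0 : ℚ.Positive δ
      δ>0 = ℚ.pos*pos⇒pos (ℚ.1/ B) (½ ℚ.* ε)
    eq : B ℚ.* δ ≡ ½ ℚ.* ε
    eq = trans (sym (ℚ.*-assoc B (ℚ.1/ B) (½ ℚ.* ε)))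
        (trans (cong (ℚ._* (½ ℚ.* ε)) (ℚ.*-inverseʳ B)) (ℚ.*-identityˡ (½ ℚ.* ε)))

  *-mono-∣∣ : ∀ p q {B δ} → ℚ.Positive B → ℚ.∣ p ∣ ℚ.≤ B → ℚ.∣ q ∣ ℚ.≤ δ →
              ℚ.∣ p ℚ.* q ∣ ℚ.≤ B ℚ.* δ
  *-mono-∣∣ p q {B} {δ} B>0 p≤B q≤δ = begin
    ℚ.∣ p ℚ.* q ∣          ≡⟨ ℚ.∣p*q∣≡∣p∣*∣q∣ p q ⟩
    ℚ.∣ p ∣ ℚ.* ℚ.∣ q ∣    ≤⟨ ℚ.*-monoʳ-≤-nonNeg ℚ.∣ q ∣ {{ℚ.nonNegative (ℚ.0≤∣p∣ q)}} p≤B ⟩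
    B ℚ.* ℚ.∣ q ∣          ≤⟨ ℚ.*-monoˡ-≤-nonNeg B {{ℚ.pos⇒nonNeg B {{B>0}}}} q≤δ ⟩
    B ℚ.* δ                ∎
    where open ℚ.≤-Reasoning

  *-cauchy : ∀ {x y} → IsCauchy x → IsCauchy y → IsCauchy (λ n → x n ℚ.* y n)
  *-cauchy {x} {y} cx cy ε 0<ε
    with eventuallyBounded cx | eventuallyBounded cy
  ... | Bx , Bx>0 , N₁ , bx | By , By>0 , N₂ , by
    with scale Bx {{Bx>0}} ε 0<ε | scale By {{By>0}} ε 0<ε
  ... | δy , δy>0 , eqx | δx , δx>0 , eqy
    with cx δx δx>0 | cy δy δy>0
  ... | N₃ , closex | N₄ , closey = N , bound
    where
    N = (N₁ ℕ.⊔ N₂) ℕ.⊔ (N₃ ℕ.⊔ N₄)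

    halves : ½ ℚ.* ε ℚ.+ ½ ℚ.* ε ≡ ε
    halves = trans (sym (ℚ.*-distribʳ-+ ε ½ ½)) (ℚ.*-identityˡ ε)

    N₁≤ : N₁ ℕ.≤ N
    N₁≤ = ℕ.≤-trans (ℕ.m≤m⊔n N₁ N₂) (ℕ.m≤m⊔n (N₁ ℕ.⊔ N₂) (N₃ ℕ.⊔ N₄))
    N₂≤ : N₂ ℕ.≤ N
    N₂≤ = ℕ.≤-trans (ℕ.m≤n⊔m N₁ N₂) (ℕ.m≤m⊔n (N₁ ℕ.⊔ N₂) (N₃ ℕ.⊔ N₄))
    N₃≤ : N₃ ℕ.≤ N
    N₃≤ = ℕ.≤-trans (ℕ.m≤m⊔n N₃ N₄) (ℕ.m≤n⊔m (N₁ ℕ.⊔ N₂) (N₃ ℕ.⊔ N₄))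
    N₄≤ : N₄ ℕ.≤ N
    N₄≤ = ℕ.≤-trans (ℕ.m≤n⊔m N₃ N₄) (ℕ.m≤n⊔m (N₁ ℕ.⊔ N₂) (N₃ ℕ.⊔ N₄))

    bound : ∀ m n → N ℕ.≤ m → N ℕ.≤ n → ℚ.∣ x m ℚ.* y m ℚ.- x n ℚ.* y n ∣ ℚ.≤ ε
    bound m n N≤m N≤n = begin
      ℚ.∣ x m ℚ.* y m ℚ.- x n ℚ.* y n ∣
        ≡⟨ cong ℚ.∣_∣ (ab-cd (x m) (y m) (x n) (y n)) ⟩
      ℚ.∣ x m ℚ.* (y m ℚ.- y n) ℚ.+ y n ℚ.* (x m ℚ.- x n) ∣
        ≤⟨ ℚ.∣p+q∣≤∣p∣+∣q∣ (x m ℚ.* (y m ℚ.- y n)) (y n ℚ.* (x m ℚ.- x n)) ⟩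
      ℚ.∣ x m ℚ.* (y m ℚ.- y n) ∣ ℚ.+ ℚ.∣ y n ℚ.* (x m ℚ.- x n) ∣
        ≤⟨ ℚ.+-mono-≤
             (*-mono-∣∣ (x m) (y m ℚ.- y n) Bx>0 (bx m (ℕ.≤-trans N₁≤ N≤m))
               (closey m n (ℕ.≤-trans N₄≤ N≤m) (ℕ.≤-trans N₄≤ N≤n)))
             (*-mono-∣∣ (y n) (x m ℚ.- x n) By>0 (by n (ℕ.≤-trans N₂≤ N≤n))
               (closex m n (ℕ.≤-trans N₃≤ N≤m) (ℕ.≤-trans N₃≤ N≤n))) ⟩
      Bx ℚ.* δy ℚ.+ By ℚ.* δx
        ≡⟨ cong₂ ℚ._+_ eqx eqy ⟩
      ½ ℚ.* ε ℚ.+ ½ ℚ.* ε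
        ≡⟨ halves ⟩
      ε ∎
      where open ℚ.≤-Reasoning

_*ᴿ_ : ℝ → ℝ → ℝ
x *ᴿ y = mkℝ (λ n → seq x n ℚ.* seq y n) (*-cauchy {seq x} {seq y} (cauchy x) (cauchy y))

_^ᴿ_ : ℝ → ℕ → ℝ
x ^ᴿ zero  = fromℕ 1
x ^ᴿ suc n = x *ᴿ (x ^ᴿ n)

-- A finite subset of R is a list of elements of R, read up to the ring's
-- equality and ignoring order and repetition.  Excluded middle makes _≈_ and
-- membership in R* decidable, so cardinalities and set differences are
-- defined for every ring.
module FiniteSubsets (em : ∀ {a} → ExcludedMiddle a)
                     {c ℓ : Level} (R : RingWithoutOne c ℓ) where

  open RingWithoutOne R
  open import Data.List.Relation.Binary.Subset.Setoid setoid public using (_⊆_)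

  R* : Pred Carrier (c ⊔ ℓ)
  R* r = ∀ a → ¬ (a ≈ 0#) → ¬ (r * a ≈ 0#) × ¬ (a * r ≈ 0#)

  infixl 6 _+ˢ_ _-ˢ_
  infixl 7 _·ˢ_
  infix  5 _∖R*

  _+ˢ_ _-ˢ_ _·ˢ_ : List Carrier → List Carrier → List Carrier
  _+ˢ_ = cartesianProductWith _+_
  _-ˢ_ = cartesianProductWith (λ a b → a + (- b))
  _·ˢ_ = cartesianProductWith _*_

  _∖R* : List Carrier → List Carrier
  A ∖R* = filter (λ r → ¬? (em {P = R* r})) A

  -- The number of pairwise inequivalent entries.
  ∣_∣ : List Carrier → ℕ
  ∣ A ∣ = length (deduplicate (λ a b → em {P = a ≈ b}) A)

-- Existence of a positive constant satisfying a property that may quantify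
-- over all universe levels, so that the constant does not depend on the level.
record ∃⁺ (P : ℕ → Setω) : Setω where
  constructor mk∃⁺
  field
    constant : ℕ
    positive : 0 ℕ.< constant
    property : P constant

{-# OPTIONS --safe #-}
module Submission where

-- By Cauchy–Schwarz on A·A some b ∈ A has at least |A|/(2K) elements a, forming A′, for
-- which aA and bA share at least |A|/(2K) elements; then aA − bA has O(K³|A|) elements.
-- The ring being noncommutative, a₁bA need not be close to bbA.  Instead choose a maximal
-- set of r ∈ A′ with pairwise disjoint dilates rA′: there are O(K²) of them, and every a₁A′
-- meets some rA′, so that a₁a₂A is close to D = rbA for all a₁, a₂ ∈ A′ with this r.
-- For y = a₁a₂, y′ = rs and c, c′ ∈ A, Cauchy–Schwarz gives many solutions of
-- y(c − c′) = d − d′, y′(c − c′) = e − e′ with d, d′, e, e′ ∈ D.  If A − A has few zero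
-- divisors, most have c − c′ ∈ R*, and such a solution determines x = y − y′ from c, c′, d, e′
-- and d′ + e, which lies in the dilate rb(A + A).  This bounds the number of differences
-- a₁a₂ − rs, and the Ruzsa triangle inequality extends the bound to A′A′ − A′A′.
-- With n = |A| and M = max(n, |A + A|, |A·A|) every estimate with K = M/n is cleared of
-- denominators and proved over ℕ.

open import Defs
open import Algebra.Bundles using (RingWithoutOne)
open import Axiom.ExcludedMiddle using (ExcludedMiddle)
open import Data.List.Base using (List; [])
open import Data.List.Relation.Unary.All using (All)
open import Data.Nat.Base using (s≤s; z≤n)
open import Data.Product using (_×_; ∃-syntax)
open import Data.Sum using (_⊎_)
open import Relation.Binary.PropositionalEquality using (_≢_)

-- Finite sums of natural numbers, Cauchy-Schwarz and counting in finite types.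

module FiniteSums where
  open import Axiom.ExcludedMiddle using (ExcludedMiddle)
  open import Data.Bool.Base using (if_then_else_)
  open import Data.Empty using (⊥-elim)
  open import Data.Fin.Base using (Fin; zero)
  open import Data.List.Base using (List; []; _∷_; _++_; length; map; allFin; cartesianProduct)
  open import Data.List.Membership.Propositional using (_∈_)
  open import Data.List.Membership.Propositional.Properties using (∈-allFin; ∈-cartesianProduct⁺)
  open import Data.List.Properties using (map-∘; map-++; length-++; length-map; length-tabulate)
  open import Data.List.Relation.Unary.All as All using (All; []; _∷_)
  open import Data.List.Relation.Unary.AllPairs using ([]; _∷_)
  open import Data.List.Relation.Unary.Any using (here; there)
  open import Data.List.Relation.Unary.Unique.Propositional using (Unique)
  open import Data.List.Relation.Unary.Unique.Propositional.Properties using (allFin⁺; cartesianProduct⁺)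
  open import Data.Nat.Base
  open import Data.Nat.ListAction using (sum)
  open import Data.Nat.ListAction.Properties using (sum-++)
  open import Data.Nat.Properties
  open import Data.Nat.Tactic.RingSolver using (solve-∀)
  open import Data.Product.Base using (_×_; _,_; ∃-syntax)
  open import Data.Sum.Base using (inj₁; inj₂)
  open import Data.Unit.Base using (⊤; tt)
  open import Relation.Binary.PropositionalEquality
  open import Relation.Nullary using (¬_; yes; no; does)

  ∑ : ∀ {a} {X : Set a} → List X → (X → ℕ) → ℕ
  ∑ xs f = sum (map f xs)

  module _ {a} {X : Set a} where

    ∑-mono : ∀ xs {f g : X → ℕ} → (∀ x → f x ≤ g x) → ∑ xs f ≤ ∑ xs g
    ∑-mono []       f≤g = z≤n
    ∑-mono (x ∷ xs) f≤g = +-mono-≤ (f≤g x) (∑-mono xs f≤g)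

    ∑-cong : ∀ xs {f g : X → ℕ} → (∀ x → f x ≡ g x) → ∑ xs f ≡ ∑ xs g
    ∑-cong []       f≡g = refl
    ∑-cong (x ∷ xs) f≡g = cong₂ _+_ (f≡g x) (∑-cong xs f≡g)

    ∑-const : ∀ (xs : List X) k → ∑ xs (λ _ → k) ≡ length xs * k
    ∑-const []       k = refl
    ∑-const (x ∷ xs) k = cong (k +_) (∑-const xs k)

    ∑-≤const : ∀ xs {f : X → ℕ} {k} → (∀ x → f x ≤ k) → ∑ xs f ≤ length xs * k
    ∑-≤const xs f≤k = ≤-trans (∑-mono xs f≤k) (≤-reflexive (∑-const xs _))

    ∑-≥const : ∀ xs {f : X → ℕ} {k} → (∀ x → k ≤ f x) → length xs * k ≤ ∑ xs f
    ∑-≥const xs k≤f = ≤-trans (≤-reflexive (sym (∑-const xs _))) (∑-mono xs k≤f)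

    ∑-*ˡ : ∀ xs k (f : X → ℕ) → ∑ xs (λ x → k * f x) ≡ k * ∑ xs f
    ∑-*ˡ []       k f = sym (*-zeroʳ k)
    ∑-*ˡ (x ∷ xs) k f = trans (cong (k * f x +_) (∑-*ˡ xs k f)) (sym (*-distribˡ-+ k (f x) (∑ xs f)))

    ∑-+ : ∀ xs (f g : X → ℕ) → ∑ xs (λ x → f x + g x) ≡ ∑ xs f + ∑ xs g
    ∑-+ []       f g = refl
    ∑-+ (x ∷ xs) f g = trans (cong (f x + g x +_) (∑-+ xs f g)) (lemma (f x) (g x) (∑ xs f) (∑ xs g))
      where
      lemma : ∀ a b c d → a + b + (c + d) ≡ a + c + (b + d)
      lemma = solve-∀

    term≤∑ : ∀ {xs x} (f : X → ℕ) → x ∈ xs → f x ≤ ∑ xs f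
    term≤∑ f (here refl)           = m≤m+n _ _
    term≤∑ f (there {x = y} x∈xs) = ≤-trans (term≤∑ f x∈xs) (m≤n+m _ (f y))

  module _ {a b} {X : Set a} {Y : Set b} where

    ∑-swap : ∀ xs ys (f : X → Y → ℕ) →
             ∑ xs (λ x → ∑ ys (f x)) ≡ ∑ ys (λ y → ∑ xs (λ x → f x y))
    ∑-swap []       ys f = sym (trans (∑-const ys 0) (*-zeroʳ (length ys)))
    ∑-swap (x ∷ xs) ys f = trans (cong (∑ ys (f x) +_) (∑-swap xs ys f))
      (sym (∑-+ ys (f x) (λ y → ∑ xs (λ x → f x y))))

    ∑-× : ∀ xs ys (f : X × Y → ℕ) →
          ∑ (cartesianProduct xs ys) f ≡ ∑ xs (λ x → ∑ ys (λ y → f (x , y)))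
    ∑-× []       ys f = refl
    ∑-× (x ∷ xs) ys f = begin
      sum (map f (map (x ,_) ys ++ cartesianProduct xs ys))
        ≡⟨ cong sum (map-++ f (map (x ,_) ys) (cartesianProduct xs ys)) ⟩
      sum (map f (map (x ,_) ys) ++ map f (cartesianProduct xs ys))
        ≡⟨ sum-++ (map f (map (x ,_) ys)) _ ⟩
      sum (map f (map (x ,_) ys)) + ∑ (cartesianProduct xs ys) f
        ≡⟨ cong₂ _+_ (cong sum (sym (map-∘ ys))) (∑-× xs ys f) ⟩
      ∑ ys (λ y → f (x , y)) + ∑ xs (λ x → ∑ ys (λ y → f (x , y))) ∎
      where open ≡-Reasoning

  -- Subtraction on ℕ is truncated, so the larger number is written as the smaller plus d; the two
  -- sides then differ by d².
  2mn≤m²+n² : ∀ m n → 2 * (m * n) ≤ m * m + n * n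
  2mn≤m²+n² m n with ≤-total m n
  ... | inj₁ m≤n = subst (λ n → 2 * (m * n) ≤ m * m + n * n) (m+[n∸m]≡n m≤n) (square m (n ∸ m))
    where
    rearrange : ∀ m d → 2 * (m * (m + d)) + d * d ≡ m * m + (m + d) * (m + d)
    rearrange = solve-∀
    square : ∀ m d → 2 * (m * (m + d)) ≤ m * m + (m + d) * (m + d)
    square m d = ≤-trans (m≤m+n _ (d * d)) (≤-reflexive (rearrange m d))
  ... | inj₂ n≤m = subst (λ m → 2 * (m * n) ≤ m * m + n * n) (m+[n∸m]≡n n≤m) (square n (m ∸ n))
    where
    rearrange : ∀ n d → 2 * ((n + d) * n) + d * d ≡ (n + d) * (n + d) + n * n
    rearrange = solve-∀
    square : ∀ n d → 2 * ((n + d) * n) ≤ (n + d) * (n + d) + n * n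
    square n d = ≤-trans (m≤m+n _ (d * d)) (≤-reflexive (rearrange n d))

  ∑-*-∑ : ∀ {a b} {X : Set a} {Y : Set b} xs ys (f : X → ℕ) (g : Y → ℕ) →
          ∑ xs f * ∑ ys g ≡ ∑ xs (λ x → ∑ ys (λ y → f x * g y))
  ∑-*-∑ xs ys f g = begin
    ∑ xs f * ∑ ys g                    ≡⟨ *-comm (∑ xs f) (∑ ys g) ⟩
    ∑ ys g * ∑ xs f                    ≡⟨ ∑-*ˡ xs (∑ ys g) f ⟨
    ∑ xs (λ x → ∑ ys g * f x)          ≡⟨ ∑-cong xs (λ x → *-comm (∑ ys g) (f x)) ⟩
    ∑ xs (λ x → f x * ∑ ys g)          ≡⟨ ∑-cong xs (λ x → sym (∑-*ˡ ys (f x) g)) ⟩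
    ∑ xs (λ x → ∑ ys (λ y → f x * g y)) ∎
    where open ≡-Reasoning

  -- Twice either side is a double sum over pairs (x, y), and the terms compare by 2 f(x) f(y) ≤
  -- f(x)² + f(y)².
  cauchy-schwarz : ∀ {a} {X : Set a} xs (f : X → ℕ) →
                   ∑ xs f * ∑ xs f ≤ length xs * ∑ xs (λ x → f x * f x)
  cauchy-schwarz xs f = *-cancelˡ-≤ 2 (begin
    2 * (S * S)
      ≡⟨ cong (2 *_) (∑-*-∑ xs xs f f) ⟩
    2 * ∑ xs (λ x → ∑ xs (λ y → f x * f y))
      ≡⟨ ∑-*ˡ xs 2 _ ⟨
    ∑ xs (λ x → 2 * ∑ xs (λ y → f x * f y))
      ≡⟨ ∑-cong xs (λ x → sym (∑-*ˡ xs 2 _)) ⟩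
    ∑ xs (λ x → ∑ xs (λ y → 2 * (f x * f y)))
      ≤⟨ ∑-mono xs (λ x → ∑-mono xs (λ y → 2mn≤m²+n² (f x) (f y))) ⟩
    ∑ xs (λ x → ∑ xs (λ y → f x * f x + f y * f y))
      ≡⟨ ∑-cong xs (λ x → ∑-+ xs (λ _ → f x * f x) (λ y → f y * f y)) ⟩
    ∑ xs (λ x → ∑ xs (λ _ → f x * f x) + Q)
      ≡⟨ ∑-+ xs (λ x → ∑ xs (λ _ → f x * f x)) (λ _ → Q) ⟩
    ∑ xs (λ x → ∑ xs (λ _ → f x * f x)) + ∑ xs (λ _ → Q)
      ≡⟨ cong (_+ ∑ xs (λ _ → Q)) (∑-swap xs xs (λ x _ → f x * f x)) ⟩
    ∑ xs (λ _ → Q) + ∑ xs (λ _ → Q)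
      ≡⟨ cong₂ _+_ (∑-const xs Q) (trans (∑-const xs Q) (sym (+-identityʳ _))) ⟩
    2 * (length xs * Q) ∎)
    where
    open ≤-Reasoning
    S = ∑ xs f
    Q = ∑ xs (λ x → f x * f x)

  record Finite (X : Set) (N : ℕ) : Set where
    field
      enum        : List X
      length-enum : length enum ≡ N
      unique      : Unique enum
      complete    : ∀ x → x ∈ enum
  open Finite

  ∑F : ∀ {X N} → Finite X N → (X → ℕ) → ℕ
  ∑F F = ∑ (enum F)

  fin : ∀ n → Finite (Fin n) n
  fin n = record
    { enum = allFin n ; length-enum = length-tabulate (λ i → i)
    ; unique = allFin⁺ n ; complete = ∈-allFin }

  infixr 2 _⊗_
  _⊗_ : ∀ {X Y M N} → Finite X M → Finite Y N → Finite (X × Y) (M * N)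
  F ⊗ G = record
    { enum        = cartesianProduct (enum F) (enum G)
    ; length-enum = trans (length-× (enum F) (enum G)) (cong₂ _*_ (length-enum F) (length-enum G))
    ; unique      = cartesianProduct⁺ (unique F) (unique G)
    ; complete    = λ (x , y) → ∈-cartesianProduct⁺ (complete F x) (complete G y)
    }
    where
    length-× : ∀ {X Y : Set} (xs : List X) (ys : List Y) →
               length (cartesianProduct xs ys) ≡ length xs * length ys
    length-× []       ys = refl
    length-× (x ∷ xs) ys = trans (length-++ (map (x ,_) ys))
      (cong₂ _+_ (length-map (x ,_) ys) (length-× xs ys))

  -- The maximum is at least the average; x is a point where f is maximal.
  popular : ∀ {X n} (F : Finite X n) (f : X → ℕ) → 0 < n → ∃[ x ] ∑F F f ≤ n * f x
  popular F f 0<n with enum F | length-enum F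
  ... | []     | refl = ⊥-elim (n≮n 0 0<n)
  ... | x ∷ xs | refl = let y , max = argmax x xs in y , ∑≤ (x ∷ xs) max
    where
    ∑≤ : ∀ ys {k} → All (λ y → f y ≤ k) ys → ∑ ys f ≤ length ys * k
    ∑≤ []       []       = z≤n
    ∑≤ (y ∷ ys) (p ∷ ps) = +-mono-≤ p (∑≤ ys ps)
    argmax : ∀ x xs → ∃[ y ] All (λ z → f z ≤ f y) (x ∷ xs)
    argmax x []       = x , ≤-refl ∷ []
    argmax x (z ∷ zs) with argmax z zs
    ... | y , max with ≤-total (f x) (f y)
    ...   | inj₁ x≤y = y , x≤y ∷ max
    ...   | inj₂ y≤x = x , ≤-refl ∷ All.map (λ p → ≤-trans p y≤x) max

  -- Counting the solutions of a predicate.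

  module Counting (em : ∀ {a} → ExcludedMiddle a) where

    -- The Iverson bracket, with excluded middle deciding P.
    ⟦_⟧ : ∀ {p} → Set p → ℕ
    ⟦ P ⟧ = if does (em {P = P}) then 1 else 0

    ⟦⟧-yes : ∀ {p} {P : Set p} → P → ⟦ P ⟧ ≡ 1
    ⟦⟧-yes {P = P} p with em {P = P}
    ... | yes _ = refl
    ... | no ¬p = ⊥-elim (¬p p)

    ⟦⟧-no : ∀ {p} {P : Set p} → ¬ P → ⟦ P ⟧ ≡ 0
    ⟦⟧-no {P = P} ¬p with em {P = P}
    ... | yes p = ⊥-elim (¬p p)
    ... | no _  = refl

    ⟦⟧-≤ : ∀ {p} {P : Set p} {k} → (P → 1 ≤ k) → ⟦ P ⟧ ≤ k
    ⟦⟧-≤ {P = P} P⇒1≤k with em {P = P}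
    ... | yes p = P⇒1≤k p
    ... | no _  = z≤n

    ⟦⟧-mono : ∀ {p q} {P : Set p} {Q : Set q} → (P → Q) → ⟦ P ⟧ ≤ ⟦ Q ⟧
    ⟦⟧-mono P⇒Q = ⟦⟧-≤ (λ p → ≤-reflexive (sym (⟦⟧-yes (P⇒Q p))))

    count : ∀ {X N p} → Finite X N → (X → Set p) → ℕ
    count F P = ∑F F (λ x → ⟦ P x ⟧)

    count≤ : ∀ {X N p} (F : Finite X N) (P : X → Set p) → count F P ≤ N
    count≤ F P = begin
      count F P           ≤⟨ ∑-≤const (enum F) (λ x → ⟦⟧-≤ (λ _ → ≤-refl)) ⟩
      length (enum F) * 1 ≡⟨ trans (*-identityʳ _) (length-enum F) ⟩
      _                   ∎
      where open ≤-Reasoning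

    count-mono : ∀ {X N p q} (F : Finite X N) {P : X → Set p} {Q : X → Set q} →
                 (∀ x → P x → Q x) → count F P ≤ count F Q
    count-mono F P⇒Q = ∑-mono (enum F) (λ x → ⟦⟧-mono (P⇒Q x))

    count-× : ∀ {X Y M N p} (F : Finite X M) (G : Finite Y N) (P : X × Y → Set p) →
              count (F ⊗ G) P ≡ ∑F F (λ x → count G (λ y → P (x , y)))
    count-× F G P = ∑-× (enum F) (enum G) _

    -- Double counting of the pairs (x, y) with `P x`, `ρ x y` and `Q y`: each x in P lies in at
    -- least one of them, each y in at most `⟦ Q y ⟧`. Pairing by a relation lets the partner of x
    -- depend on the proof of `P x`.
    count-≤ : ∀ {X Y M N p r q} (F : Finite X M) (G : Finite Y N)
              {P : X → Set p} {Q : Y → Set q} (ρ : X → Y → Set r) →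
              (∀ x → P x → ∃[ y ] ρ x y × Q y) →
              (∀ x x′ y → P x → P x′ → ρ x y → ρ x′ y → x ≡ x′) →
              count F P ≤ count G Q
    count-≤ F G {P} {Q} ρ partner injective = begin
      ∑F F (λ x → ⟦ P x ⟧)
        ≤⟨ ∑-mono (enum F) (λ x → ⟦⟧-≤ (λ px → let y , xρy , qy = partner x px in
             ≤-trans (≤-reflexive (sym (⟦⟧-yes (px , xρy , qy))))
                     (term≤∑ (λ y → ⟦ R x y ⟧) (complete G y)))) ⟩
      ∑F F (λ x → ∑F G (λ y → ⟦ R x y ⟧))
        ≡⟨ ∑-swap (enum F) (enum G) _ ⟩
      ∑F G (λ y → ∑F F (λ x → ⟦ R x y ⟧))
        ≤⟨ ∑-mono (enum G) (λ y → at-most-one y (enum F) (unique F)) ⟩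
      ∑F G (λ y → ⟦ Q y ⟧) ∎
      where
      open ≤-Reasoning
      R = λ x y → P x × ρ x y × Q y
      none : ∀ y xs → (∀ x → x ∈ xs → ¬ R x y) → ∑ xs (λ x → ⟦ R x y ⟧) ≡ 0
      none y []       h = refl
      none y (x ∷ xs) h = cong₂ _+_ (⟦⟧-no (h x (here refl))) (none y xs (λ z z∈ → h z (there z∈)))
      at-most-one : ∀ y xs → Unique xs → ∑ xs (λ x → ⟦ R x y ⟧) ≤ ⟦ Q y ⟧
      at-most-one y []       _            = z≤n
      at-most-one y (x ∷ xs) (x∉xs ∷ xs!) with em {P = R x y}
      ... | no _ = at-most-one y xs xs!
      ... | yes (px , xρy , qy) = ≤-reflexive (trans
        (cong suc (none y xs λ z z∈xs (pz , zρy , _) →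
          All.lookup x∉xs z∈xs (injective x z y px pz xρy zρy)))
        (sym (⟦⟧-yes qy)))

    injection-≤ : ∀ {X Y M N} (F : Finite X M) (G : Finite Y N) (f : X → Y) →
                  (∀ x x′ → f x ≡ f x′ → x ≡ x′) → M ≤ N
    injection-≤ {M = M} {N} F G f injective = begin
      M                               ≡⟨ all F ⟨
      count F (λ _ → ⊤)           ≤⟨ count-≤ F G {P = λ _ → ⊤} {Q = λ _ → ⊤} (λ x y → f x ≡ y) (λ x _ → f x , refl , tt)
                                           (λ x x′ y _ _ p q → injective x x′ (trans p (sym q))) ⟩
      count G (λ _ → ⊤)           ≡⟨ all G ⟩
      N                               ∎
      where
      open ≤-Reasoning
      all : ∀ {X N} (F : Finite X N) → count F (λ _ → ⊤) ≡ N
      all F = trans (∑-cong (enum F) (λ _ → ⟦⟧-yes tt))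
        (trans (∑-const (enum F) 1) (trans (*-identityʳ _) (length-enum F)))

    -- The fibres of φ have total size M, so by Cauchy-Schwarz over the N labels M² is at most N
    -- times the sum of the squared fibre sizes. That sum counts the pairs lying in a common fibre.
    collisions : ∀ {X Y M N} (F : Finite X M) (G : Finite Y N) (φ : X → Y) →
                 M * M ≤ N * count (F ⊗ F) (λ (x , x′) → φ x ≡ φ x′)
    collisions {M = M} {N} F G φ = begin
      M * M
        ≤⟨ *-mono-≤ M≤ M≤ ⟩
      ∑F G fibre * ∑F G fibre
        ≤⟨ cauchy-schwarz (enum G) fibre ⟩
      length (enum G) * ∑F G (λ y → fibre y * fibre y)
        ≡⟨ cong₂ _*_ (length-enum G) (∑-cong (enum G) (λ y →
             ∑-*-∑ (enum F) (enum F) (λ x → ⟦ φ x ≡ y ⟧) (λ x → ⟦ φ x ≡ y ⟧))) ⟩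
      N * ∑F G (λ y → ∑F F (λ x → ∑F F (λ x′ → ⟦ φ x ≡ y ⟧ * ⟦ φ x′ ≡ y ⟧)))
        ≡⟨ cong (N *_) (∑-swap (enum G) (enum F) _) ⟩
      N * ∑F F (λ x → ∑F G (λ y → ∑F F (λ x′ → ⟦ φ x ≡ y ⟧ * ⟦ φ x′ ≡ y ⟧)))
        ≡⟨ cong (N *_) (∑-cong (enum F) (λ x → ∑-swap (enum G) (enum F) _)) ⟩
      N * ∑F F (λ x → ∑F F (λ x′ → ∑F G (λ y → ⟦ φ x ≡ y ⟧ * ⟦ φ x′ ≡ y ⟧)))
        ≤⟨ *-monoʳ-≤ N (∑-mono (enum F) λ x → ∑-mono (enum F) λ x′ → common x x′) ⟩
      N * ∑F F (λ x → ∑F F (λ x′ → ⟦ φ x ≡ φ x′ ⟧))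
        ≡⟨ cong (N *_) (sym (count-× F F _)) ⟩
      N * count (F ⊗ F) (λ (x , x′) → φ x ≡ φ x′) ∎
      where
      open ≤-Reasoning
      fibre = λ y → ∑F F (λ x → ⟦ φ x ≡ y ⟧)
      M≤ : M ≤ ∑F G fibre
      M≤ = begin
        M                                   ≡⟨ length-enum F ⟨
        length (enum F)                     ≡⟨ *-identityʳ _ ⟨
        length (enum F) * 1                 ≤⟨ ∑-≥const (enum F) (λ x →
          ≤-trans (≤-reflexive (sym (⟦⟧-yes refl))) (term≤∑ (λ y → ⟦ φ x ≡ y ⟧) (complete G (φ x)))) ⟩
        ∑F F (λ x → ∑F G (λ y → ⟦ φ x ≡ y ⟧)) ≡⟨ ∑-swap (enum F) (enum G) _ ⟩
        ∑F G fibre                          ∎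
      common : ∀ x x′ → ∑F G (λ y → ⟦ φ x ≡ y ⟧ * ⟦ φ x′ ≡ y ⟧) ≤ ⟦ φ x ≡ φ x′ ⟧
      common x x′ with em {P = φ x ≡ φ x′}
      ... | yes eq = begin
        ∑F G (λ y → ⟦ φ x ≡ y ⟧ * ⟦ φ x′ ≡ y ⟧)
          ≤⟨ ∑-mono (enum G) (λ y → ≤-trans (*-monoʳ-≤ ⟦ φ x ≡ y ⟧ (⟦⟧-≤ {k = 1} (λ _ → ≤-refl)))
               (≤-reflexive (*-identityʳ _))) ⟩
        count G (φ x ≡_)
          ≤⟨ count-≤ G (fin 1) {P = φ x ≡_} {Q = λ _ → ⊤} (λ _ _ → ⊤) (λ _ _ → zero , tt , tt)
               (λ y y′ _ p q _ _ → trans (sym p) q) ⟩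
        count (fin 1) (λ _ → ⊤)
          ≤⟨ count≤ (fin 1) (λ _ → ⊤) ⟩
        1 ∎
      ... | no neq = ≤-reflexive (trans (∑-cong (enum G) zero-term) (trans (∑-const (enum G) 0) (*-zeroʳ (length (enum G)))))
        where
        zero-term : ∀ y → ⟦ φ x ≡ y ⟧ * ⟦ φ x′ ≡ y ⟧ ≡ 0
        zero-term y with em {P = φ x ≡ y} | em {P = φ x′ ≡ y}
        ... | no _  | _     = refl
        ... | yes _ | no _  = refl
        ... | yes p | yes q = ⊥-elim (neq (trans p (sym q)))

-- Maximal separated families and finite subsets of a ring.

module FiniteRingSubsets where
  open import Algebra.Bundles using (RingWithoutOne)
  import Algebra.Properties.RingWithoutOne as RingProperties
  open import Axiom.ExcludedMiddle using (ExcludedMiddle)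
  open import Data.Empty using (⊥-elim)
  open import Data.Fin.Base using (Fin; zero; suc)
  open import Data.List.Base using (List; []; _∷_; length; map; allFin; cartesianProductWith; deduplicate; lookup)
  open import Data.List.Membership.Propositional.Properties using (∈-lookup; ∈-allFin)
  import Data.List.Membership.Setoid as Membership
  import Data.List.Membership.Setoid.Properties as Membershipₚ
  open import Data.List.Relation.Unary.All as All using (All; []; _∷_)
  import Data.List.Relation.Unary.All.Properties as All
  open import Data.List.Relation.Unary.AllPairs using (AllPairs; []; _∷_)
  open import Data.List.Relation.Unary.Any as Any using (Any; here; there)
  import Data.List.Relation.Unary.Any.Properties as Any
  import Data.List.Relation.Unary.Unique.DecSetoid.Properties as Unique
  open import Data.Nat.Base using (ℕ)
  open import Data.Product.Base using (_×_; _,_; ∃-syntax; proj₁; proj₂)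
  open import Level using (_⊔_)
  open import Relation.Binary.Bundles using (DecSetoid)
  open import Relation.Binary.PropositionalEquality as ≡ using (_≡_)
  open import Relation.Nullary using (¬_; yes; no)
  open FiniteSums

  lookup-injective : ∀ {a r} {X : Set a} {R : X → X → Set r} → (∀ {x y} → R x y → R y x) →
                     ∀ {xs} → AllPairs (λ x y → ¬ R x y) xs →
                     ∀ i j → R (lookup xs i) (lookup xs j) → i ≡ j
  lookup-injective R-sym (x∉xs ∷ xs!) zero    zero    r = ≡.refl
  lookup-injective R-sym (x∉xs ∷ xs!) zero    (suc j) r = ⊥-elim (All.lookup x∉xs (∈-lookup j) r)
  lookup-injective R-sym (x∉xs ∷ xs!) (suc i) zero    r = ⊥-elim (All.lookup x∉xs (∈-lookup i) (R-sym r))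
  lookup-injective R-sym (x∉xs ∷ xs!) (suc i) (suc j) r = ≡.cong suc (lookup-injective R-sym xs! i j r)

  -- A maximal family of pairwise unrelated indices instead of a quotient. The relation used later,
  -- that two dilates meet, is reflexive and symmetric; an index may be related to several
  -- representatives, and `rep` selects one.
  record Representatives {k r} (R : Fin k → Fin k → Set r) : Set r where
    field
      size        : ℕ
      ρ           : Fin size → Fin k
      rep         : Fin k → Fin size
      related     : ∀ i → R (ρ (rep i)) i
      ρ-separated : ∀ i j → R (ρ i) (ρ j) → i ≡ j

  -- Greedy choice: an index joins the list exactly when nothing chosen so far is related to it.
  representatives : (∀ {a} → ExcludedMiddle a) → ∀ {k r} {R : Fin k → Fin k → Set r} →
                    (∀ {i} → R i i) → (∀ {i j} → R i j → R j i) → Representatives R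
  representatives em {k} {r} {R} R-refl R-sym =
    let xs , separated , covering = maximal (allFin k)
        found = λ i → All.lookup covering (∈-allFin i)
    in record
      { size = length xs ; ρ = lookup xs ; rep = λ i → Any.index (found i)
      ; related = λ i → Any.lookup-index (found i)
      ; ρ-separated = lookup-injective R-sym separated }
    where
    maximal : ∀ ys → ∃[ xs ] AllPairs (λ x y → ¬ R x y) xs × All (λ y → Any (λ x → R x y) xs) ys
    maximal []       = [] , [] , []
    maximal (y ∷ ys) with maximal ys
    ... | xs , separated , covering with em {P = Any (λ x → R x y) xs}
    ...   | yes any = xs , separated , any ∷ covering
    ...   | no none = y ∷ xs , All.map (λ ¬r r → ¬r (R-sym r)) (All.¬Any⇒All¬ xs none) ∷ separated
                             , here R-refl ∷ All.map there covering

  -- Cancellation of non-zero-divisors, and sets of values as labelled families.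

  module Sets (em : ∀ {a} → ExcludedMiddle a) {c ℓ} (R : RingWithoutOne c ℓ) where
    open RingWithoutOne R
    open FiniteSubsets em R
    open RingProperties R
    open Membership setoid using (_∈_)
    open Counting em
    open import Relation.Binary.Reasoning.Setoid setoid

    telescope : ∀ x y z → (x - y) + (y - z) ≈ x - z
    telescope x y z = begin
      (x - y) + (y - z)     ≈⟨ +-assoc x (- y) (y - z) ⟩
      x + (- y + (y - z))   ≈⟨ +-congˡ (+-assoc (- y) y (- z)) ⟨
      x + ((- y + y) - z)   ≈⟨ +-congˡ (+-congʳ (-‿inverseˡ y)) ⟩
      x + (0# - z)          ≈⟨ +-congˡ (+-identityˡ (- z)) ⟩
      x - z                 ∎

    -‿cong₂ : ∀ {x x′ y y′} → x ≈ x′ → y ≈ y′ → x - y ≈ x′ - y′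
    -‿cong₂ p q = +-cong p (-‿cong q)

    -‿exchange : ∀ {w x y z} → w - x ≈ y - z → w - y ≈ x - z
    -‿exchange {w} {x} {y} {z} eq = begin
      w - y             ≈⟨ telescope w x y ⟨
      (w - x) + (x - y) ≈⟨ +-congʳ eq ⟩
      (y - z) + (x - y) ≈⟨ +-comm _ _ ⟩
      (x - y) + (y - z) ≈⟨ telescope x y z ⟩
      x - z             ∎

    -‿cancelˡ : ∀ x {y z} → x - y ≈ x - z → y ≈ z
    -‿cancelˡ x eq = -‿injective (+-cancelˡ x _ _ eq)

    -‿cancelʳ : ∀ x {y z} → y - x ≈ z - x → y ≈ z
    -‿cancelʳ x eq = +-cancelʳ (- x) _ _ eq

    [x+z]-[y+z]≈x-y : ∀ x y z → (x + z) - (y + z) ≈ x - y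
    [x+z]-[y+z]≈x-y x y z = -‿exchange (trans (xyx⁻¹≈y x z) (sym (xyx⁻¹≈y y z)))

    [x-z]-[y-z]≈x-y : ∀ x y z → (x - z) - (y - z) ≈ x - y
    [x-z]-[y-z]≈x-y x y z = [x+z]-[y+z]≈x-y x y (- z)

    [w-x]-[y-z]≈[w+z]-[x+y] : ∀ w x y z → (w - x) - (y - z) ≈ (w + z) - (x + y)
    [w-x]-[y-z]≈[w+z]-[x+y] w x y z = begin
      (w - x) - (y - z)                             ≈⟨ +-cong (sym ([x+z]-[y+z]≈x-y w x z)) (⁻¹-anti-homo‿- y z) ⟩
      ((w + z) - (x + z)) + (z - y)                 ≈⟨ +-congˡ ([x+z]-[y+z]≈x-y z y x) ⟨
      ((w + z) - (x + z)) + ((z + x) - (y + x))     ≈⟨ +-congˡ (-‿cong₂ (+-comm z x) (+-comm y x)) ⟩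
      ((w + z) - (x + z)) + ((x + z) - (x + y))     ≈⟨ telescope _ _ _ ⟩
      (w + z) - (x + y)                             ∎

    R*-resp-≈ : ∀ {r s} → r ≈ s → R* r → R* s
    R*-resp-≈ r≈s r∈R* a a≉0 =
      let ra≉0 , ar≉0 = r∈R* a a≉0
      in (λ eq → ra≉0 (trans (*-congʳ r≈s) eq)) , (λ eq → ar≉0 (trans (*-congˡ r≈s) eq))

    R*-* : ∀ {r s} → R* r → R* s → R* (r * s)
    R*-* {r} {s} r∈R* s∈R* a a≉0 =
      (λ eq → proj₁ (r∈R* (s * a) (proj₁ (s∈R* a a≉0))) (trans (sym (*-assoc r s a)) eq)) ,
      (λ eq → proj₂ (s∈R* (a * r) (proj₂ (r∈R* a a≉0))) (trans (*-assoc a r s) eq))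

    *-cancelˡ : ∀ {r} → R* r → ∀ {x y} → r * x ≈ r * y → x ≈ y
    *-cancelˡ {r} r∈R* {x} {y} eq with em {P = x - y ≈ 0#}
    ... | yes x-y≈0 = x∙y⁻¹≈ε⇒x≈y x y x-y≈0
    ... | no x-y≉0  = ⊥-elim (proj₁ (r∈R* (x - y) x-y≉0)
      (trans (x[y-z]≈xy-xz r x y) (x≈y⇒x∙y⁻¹≈ε eq)))

    *-cancelʳ : ∀ {r} → R* r → ∀ {x y} → x * r ≈ y * r → x ≈ y
    *-cancelʳ {r} r∈R* {x} {y} eq with em {P = x - y ≈ 0#}
    ... | yes x-y≈0 = x∙y⁻¹≈ε⇒x≈y x y x-y≈0
    ... | no x-y≉0  = ⊥-elim (proj₂ (r∈R* (x - y) x-y≉0)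
      (trans ([y-z]x≈yx-zx r x y) (x≈y⇒x∙y⁻¹≈ε eq)))

    decSetoid : DecSetoid c ℓ
    decSetoid = record { isDecEquivalence = record { isEquivalence = isEquivalence ; _≟_ = λ x y → em } }

    private
      dedup : List Carrier → List Carrier
      dedup = deduplicate (λ x y → em {P = x ≈ y})

    el : ∀ L → Fin ∣ L ∣ → Carrier
    el L = lookup (dedup L)

    el-injective : ∀ L i j → el L i ≈ el L j → i ≡ j
    el-injective L = lookup-injective sym (Unique.deduplicate-! decSetoid L)

    el-All : ∀ {p} {P : Carrier → Set p} L → All P L → ∀ i → P (el L i)
    el-All L all i = All.lookup (All.deduplicate⁺ (λ x y → em {P = x ≈ y}) all) (∈-lookup i)

    el-∈ : ∀ L i → el L i ∈ L
    el-∈ L i = Membershipₚ.∈-deduplicate⁻ setoid (λ x y → em {P = x ≈ y}) L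
      (Membershipₚ.∈-lookup setoid (dedup L) i)

    private
      ∈-dedup : ∀ {L x} → x ∈ L → x ∈ dedup L
      ∈-dedup = Membershipₚ.∈-deduplicate⁺ setoid (λ x y → em {P = x ≈ y})
        (λ y≈z x≈y → trans x≈y (sym y≈z))

    index : ∀ {L x} → x ∈ L → Fin ∣ L ∣
    index x∈L = Any.index (∈-dedup x∈L)

    el-index : ∀ {L x} (x∈L : x ∈ L) → x ≈ el L (index x∈L)
    el-index x∈L = Any.lookup-index (∈-dedup x∈L)

    index-injective : ∀ {L x y} (x∈L : x ∈ L) (y∈L : y ∈ L) → index x∈L ≡ index y∈L → x ≈ y
    index-injective {L} x∈L y∈L eq =
      trans (el-index x∈L) (trans (reflexive (≡.cong (el L) eq)) (sym (el-index y∈L)))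

    -- The set of values of f, of size N: `ι` labels the value at a point and `σ` picks a point for
    -- each label. In an injection, `σ` serves where the set is the source and `ι` where it is the
    -- target.
    record Image {X : Set} (f : X → Carrier) (N : ℕ) : Set ℓ where
      field
        ι           : X → Fin N
        σ           : Fin N → X
        ι-sound     : ∀ {x y} → ι x ≡ ι y → f x ≈ f y
        σ-injective : ∀ {i j} → f (σ i) ≈ f (σ j) → i ≡ j

    Enumerates : {X : Set} → (X → Carrier) → List Carrier → Set (c ⊔ ℓ)
    Enumerates f L = (∀ x → f x ∈ L) × (∀ {v} → v ∈ L → ∃[ x ] v ≈ f x)

    image : ∀ {X f L} → Enumerates {X} f L → Image f ∣ L ∣
    image {f = f} {L} (member , origin) = record
      { ι = λ x → index (member x)
      ; σ = σ
      ; ι-sound = λ eq → index-injective (member _) (member _) eq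
      ; σ-injective = λ {i} {j} eq → el-injective L i j (trans (σ-el i) (trans eq (sym (σ-el j))))
      }
      where
      σ = λ i → proj₁ (origin (el-∈ L i))
      σ-el : ∀ i → el L i ≈ f (σ i)
      σ-el i = proj₂ (origin (el-∈ L i))

    el-enumerates : ∀ L → Enumerates (el L) L
    el-enumerates L = el-∈ L , λ v∈L → index v∈L , el-index v∈L

    map-enumerates : ∀ {X N} (F : Finite X N) (f : X → Carrier) → Enumerates f (map f (Finite.enum F))
    map-enumerates F f =
      (λ x → Any.map⁺ (Any.map (λ eq → reflexive (≡.cong f eq)) (Finite.complete F x))) ,
      (λ v∈ → Any.satisfied (Any.map⁻ v∈))

    cartesianProductWith-enumerates :
      ∀ {X Y f g A B} (_∙_ : Carrier → Carrier → Carrier) →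
      (∀ {x x′ y y′} → x ≈ x′ → y ≈ y′ → x ∙ y ≈ x′ ∙ y′) →
      Enumerates {X} f A → Enumerates {Y} g B →
      Enumerates (λ (x , y) → f x ∙ g y) (cartesianProductWith _∙_ A B)
    cartesianProductWith-enumerates {A = A} {B} _∙_ ∙-cong (f∈ , f-origin) (g∈ , g-origin) =
      (λ (x , y) → Membershipₚ.∈-cartesianProductWith⁺ setoid setoid setoid ∙-cong (f∈ x) (g∈ y)) ,
      (λ v∈ → let a , b , a∈A , b∈B , v≈ab = Membershipₚ.∈-cartesianProductWith⁻ setoid setoid setoid _∙_ A B v∈
                  x , a≈ = f-origin a∈A
                  y , b≈ = g-origin b∈B
              in (x , y) , trans v≈ab (∙-cong a≈ b≈))

-- Difference sets of dilates uA - vA.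

module DilateCounting where
  open import Algebra.Bundles using (RingWithoutOne)
  import Algebra.Properties.RingWithoutOne as RingProperties
  open import Axiom.ExcludedMiddle using (ExcludedMiddle)
  open import Data.Fin.Base using (Fin; inject≤; fromℕ<)
  open import Data.Fin.Properties using (inject≤-injective)
  open import Data.List.Base using (map)
  open import Data.Nat.Base using (ℕ) renaming (_*_ to _*ℕ_; _≤_ to _≤ℕ_; _<_ to _<ℕ_)
  import Data.Nat.Properties as ℕ
  open import Data.Product.Base using (Σ; _×_; _,_; ∃-syntax; proj₁; proj₂; swap)
  open import Data.Unit.Base using (⊤; tt)
  open import Relation.Binary.PropositionalEquality as ≡ using (_≡_)
  open import Relation.Nullary using (¬_)
  open FiniteSums
  open FiniteRingSubsets

  module Core (em : ∀ {a} → ExcludedMiddle a) {c ℓ} (R : RingWithoutOne c ℓ) where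
    open RingWithoutOne R
    open FiniteSubsets em R
    open RingProperties R
    open Counting em
    open Sets em R
    open Finite

    -- `α` lists A without repetition; `p` and `q` are |A + A| and |A·A|.
    module Dilates {n} (α : Fin n → Carrier) (α-injective : ∀ i j → α i ≈ α j → i ≡ j)
             (α∈R* : ∀ i → R* (α i))
             {p} (sums : Image {Fin n × Fin n} (λ (i , j) → α i + α j) p)
             {q} (products : Image {Fin n × Fin n} (λ (i , j) → α i * α j) q)
      where

      private
        module S = Image sums
        module P = Image products

      pairs : Finite (Fin n × Fin n) (n *ℕ n)
      pairs = fin n ⊗ fin n

      -- For u, v ∈ R* this is the size of the intersection of uA and vA, since each common element
      -- then has one representation on either side.
      energy : Carrier → Carrier → ℕ
      energy u v = count pairs (λ (j , l) → u * α j ≈ v * α l)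

      -- Cauchy-Schwarz for the product map gives at least n⁴/q solutions of aᵢaⱼ = aₖaₗ. Grouped by
      -- (k, i) they are a sum of energies, and b is the k with the largest share.
      popular-dilate : 0 <ℕ n → ∃[ b ]
        (n *ℕ n) *ℕ (n *ℕ n) ≤ℕ q *ℕ (n *ℕ ∑F (fin n) (λ i → energy (α i) (α b)))
      popular-dilate 0<n =
        let b , ≤b = popular (fin n) (λ k → ∑F (fin n) (λ i → energy (α i) (α k))) 0<n
        in b , (begin
          (n *ℕ n) *ℕ (n *ℕ n)
            ≤⟨ collisions pairs (fin q) P.ι ⟩
          q *ℕ count (pairs ⊗ pairs) (λ (x , y) → P.ι x ≡ P.ι y)
            ≤⟨ ℕ.*-monoʳ-≤ q (count-mono (pairs ⊗ pairs) (λ _ → P.ι-sound)) ⟩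
          q *ℕ count (pairs ⊗ pairs) (λ ((i , j) , (k , l)) → α i * α j ≈ α k * α l)
            ≤⟨ ℕ.*-monoʳ-≤ q (count-≤ (pairs ⊗ pairs) ((fin n ⊗ fin n) ⊗ pairs)
                 (λ ((i , j) , (k , l)) y → ((k , i) , (j , l)) ≡ y)
                 (λ _ eq → _ , ≡.refl , eq) (λ { _ _ _ _ _ ≡.refl ≡.refl → ≡.refl })) ⟩
          q *ℕ count ((fin n ⊗ fin n) ⊗ pairs) (λ ((k , i) , (j , l)) → α i * α j ≈ α k * α l)
            ≡⟨ ≡.cong (q *ℕ_) (≡.trans (count-× (fin n ⊗ fin n) pairs _) (∑-× (enum (fin n)) (enum (fin n)) _)) ⟩
          q *ℕ ∑F (fin n) (λ k → ∑F (fin n) (λ i → energy (α i) (α k)))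
            ≤⟨ ℕ.*-monoʳ-≤ q ≤b ⟩
          q *ℕ (n *ℕ ∑F (fin n) (λ i → energy (α i) (α b))) ∎)
        where open ℕ.≤-Reasoning

      energy≤n : ∀ {u v} → R* u → R* v → energy u v ≤ℕ n
      energy≤n u∈R* v∈R* = ℕ.≤-trans
        (count-≤ pairs (fin n) {Q = λ _ → ⊤} (λ (j , l) i → j ≡ i) (λ _ _ → _ , ≡.refl , tt)
          (λ { (j , l) (.j , l′) .j eq eq′ ≡.refl ≡.refl →
            ≡.cong (j ,_) (α-injective l l′ (*-cancelˡ v∈R* (trans (sym eq) eq′))) }))
        (count≤ (fin n) (λ _ → ⊤))

      differences : Carrier → Carrier → Fin n × Fin n → Carrier
      differences u v (x , z) = u * α x - v * α z

      abstract
        -- The size of uA - vA. It is opaque, so that everything below reasons through the labelling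
        -- `Δ-image`.
        Δ : Carrier → Carrier → ℕ
        Δ u v = ∣ map (differences u v) (enum pairs) ∣

        Δ-image : ∀ u v → Image (differences u v) (Δ u v)
        Δ-image u v = image (map-enumerates pairs (differences u v))

      module D u v = Image (Δ-image u v)

      Δ-by-injection : ∀ u v u′ v′ →
        (∀ x z x′ z′ → differences u′ v′ (x , z) ≈ differences u′ v′ (x′ , z′) →
                       differences u v (x , z) ≈ differences u v (x′ , z′)) →
        Δ u v ≤ℕ Δ u′ v′
      Δ-by-injection u v u′ v′ inj = injection-≤ (fin _) (fin _) (λ e → D.ι u′ v′ (D.σ u v e))
        (λ e e′ eq → D.σ-injective u v (inj _ _ _ _ (D.ι-sound u′ v′ eq)))

      Δ-sym : ∀ u v → Δ u v ≤ℕ Δ v u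
      Δ-sym u v = injection-≤ (fin _) (fin _) (λ e → D.ι v u (swap (D.σ u v e)))
          (λ e e′ eq → D.σ-injective u v (negated _ _ _ _ (D.ι-sound v u eq)))
        where
        negated : ∀ x z x′ z′ → differences v u (z , x) ≈ differences v u (z′ , x′) →
                  differences u v (x , z) ≈ differences u v (x′ , z′)
        negated x z x′ z′ eq = trans (sym (⁻¹-anti-homo‿- _ _)) (trans (-‿cong eq) (⁻¹-anti-homo‿- _ _))

      -- Left multiplication by a maps uA - vA onto u′A - v′A. Without commutativity it is a common
      -- left factor that can be removed this way.
      Δ-* : ∀ {a u v u′ v′} → u′ ≈ a * u → v′ ≈ a * v → Δ u′ v′ ≤ℕ Δ u v
      Δ-* {a} {u} {v} {u′} {v′} u′≈ v′≈ = Δ-by-injection u′ v′ u v (λ x z x′ z′ eq →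
        trans (factor x z) (trans (*-congˡ eq) (sym (factor x′ z′))))
        where
        factor : ∀ x z → differences u′ v′ (x , z) ≈ a * differences u v (x , z)
        factor x z = trans (-‿cong₂ (trans (*-congʳ u′≈) (*-assoc a u (α x))) (trans (*-congʳ v′≈) (*-assoc a v (α z))))
          (sym (x[y-z]≈xy-xz a (u * α x) (v * α z)))

      -- Ruzsa's triangle inequality. If ux - wz is the chosen form of e, then (e, y) ↦ (ux - vy, vy
      -- - wz) is injective: the sum of the two entries gives e and hence x, the first entry then
      -- gives vy, and v cancels.
      Δ-triangle : ∀ u {v} w → R* v → Δ u w *ℕ n ≤ℕ Δ u v *ℕ Δ v w
      Δ-triangle u {v} w v∈R* = injection-≤ (fin _ ⊗ fin n) (fin _ ⊗ fin _) f f-injective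
        where
        f : Fin (Δ u w) × Fin n → Fin (Δ u v) × Fin (Δ v w)
        f (e , y) = let x , z = D.σ u w e in D.ι u v (x , y) , D.ι v w (y , z)
        f-injective : ∀ s t → f s ≡ f t → s ≡ t
        f-injective (e , y) (e′ , y′) eq
          with p₁ ← D.ι-sound u v (≡.cong proj₁ eq) | p₂ ← D.ι-sound v w (≡.cong proj₂ eq)
          with ≡.refl ← D.σ-injective u w {e} {e′}
                 (trans (sym (telescope _ _ _)) (trans (+-cong p₁ p₂) (telescope _ _ _)))
          = ≡.cong (e ,_) (α-injective y y′ (*-cancelˡ v∈R* (-‿cancelˡ _ p₁)))

      -- A difference ux - vz and a coincidence uaⱼ = vaₗ are sent to the two sums x + aⱼ and aₗ +
      -- z. Since u(x + aⱼ) - v(aₗ + z) = ux - vz, the sums determine the difference, hence x and z,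
      -- and then aⱼ and aₗ.
      Δ*energy≤ : ∀ u v → Δ u v *ℕ energy u v ≤ℕ p *ℕ p
      Δ*energy≤ u v = ℕ.≤-trans (ℕ.≤-reflexive (≡.sym count≡))
        (ℕ.≤-trans
          (count-≤ (fin (Δ u v) ⊗ pairs) (fin p ⊗ fin p) {Q = λ _ → ⊤}
            (λ t y → f t ≡ y) (λ t _ → f t , ≡.refl , tt)
            (λ { t t′ _ eq eq′ ≡.refl f≡ → f-injective t t′ eq eq′ (≡.sym f≡) }))
          (count≤ (fin p ⊗ fin p) (λ _ → ⊤)))
        where
        common : Fin (Δ u v) × (Fin n × Fin n) → Set ℓ
        common (_ , j , l) = u * α j ≈ v * α l
        count≡ : count (fin (Δ u v) ⊗ pairs) common ≡ Δ u v *ℕ energy u v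
        count≡ = ≡.trans (count-× (fin (Δ u v)) pairs common)
          (≡.trans (∑-const (enum (fin (Δ u v))) (energy u v))
                   (≡.cong (_*ℕ energy u v) (length-enum (fin (Δ u v)))))
        f : Fin (Δ u v) × (Fin n × Fin n) → Fin p × Fin p
        f (e , j , l) = let x , z = D.σ u v e in S.ι (x , j) , S.ι (l , z)
        value : ∀ x z j l → u * α j ≈ v * α l →
                u * (α x + α j) - v * (α l + α z) ≈ u * α x - v * α z
        value x z j l eq = begin
          u * (α x + α j) - v * (α l + α z)
            ≈⟨ -‿cong₂ (distribˡ u (α x) (α j)) (trans (distribˡ v (α l) (α z)) (+-comm _ _)) ⟩
          (u * α x + u * α j) - (v * α z + v * α l)
            ≈⟨ -‿cong₂ refl (+-congˡ (sym eq)) ⟩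
          (u * α x + u * α j) - (v * α z + u * α j)
            ≈⟨ [x+z]-[y+z]≈x-y _ _ _ ⟩
          u * α x - v * α z ∎
          where open import Relation.Binary.Reasoning.Setoid setoid
        f-injective : ∀ t t′ → common t → common t′ → f t ≡ f t′ → t ≡ t′
        f-injective (e , j , l) (e′ , j′ , l′) eq eq′ f≡
          with p₁ ← S.ι-sound (≡.cong proj₁ f≡) | p₂ ← S.ι-sound (≡.cong proj₂ f≡)
          with ≡.refl ← D.σ-injective u v {e} {e′}
                 (trans (sym (value _ _ j l eq))
                   (trans (-‿cong₂ (*-congˡ p₁) (*-congˡ p₂)) (value _ _ j′ l′ eq′)))
          with ≡.refl ← α-injective j j′ (+-cancelˡ _ _ _ p₁)
             | ≡.refl ← α-injective l l′ (+-cancelʳ _ _ _ p₂)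
          = ≡.refl

      -- The subset A′, listed by `β`, and its classes of intersecting dilates.

      module Restricted {n′} (γ : Fin n′ → Fin n) (γ-injective : ∀ i j → γ i ≡ γ j → i ≡ j)
               (b : Fin n) {τ} (Δ≤τ : ∀ i → Δ (α (γ i)) (α b) ≤ℕ τ)
        where

        β : Fin n′ → Carrier
        β i = α (γ i)

        β∈R* : ∀ i → R* (β i)
        β∈R* i = α∈R* (γ i)

        β-injective : ∀ i j → β i ≈ β j → i ≡ j
        β-injective i j eq = γ-injective i j (α-injective _ _ eq)

        -- The dilates βᵢA′ and βⱼA′ have a common element.
        _∼_ : Fin n′ → Fin n′ → Set ℓ
        i ∼ j = ∃[ k ] ∃[ l ] β i * β k ≈ β j * β l

        classes : 0 <ℕ n′ → Representatives _∼_
        classes 0<n′ = representatives em (λ {i} → fromℕ< 0<n′ , fromℕ< 0<n′ , refl)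
          (λ (k , l , eq) → l , k , sym eq)

        module Classes (reps : Representatives _∼_) where
          open Representatives reps renaming (size to m)

          -- The m representative dilates are pairwise disjoint, have n′ elements each and lie in
          -- A·A.
          m*n′≤q : m *ℕ n′ ≤ℕ q
          m*n′≤q = injection-≤ (fin m ⊗ fin n′) (fin q) (λ (k , i) → P.ι (γ (ρ k) , γ i)) injective
            where
            injective : ∀ s t → P.ι (γ (ρ (proj₁ s)) , γ (proj₂ s)) ≡ P.ι (γ (ρ (proj₁ t)) , γ (proj₂ t)) → s ≡ t
            injective (k , i) (k′ , i′) eq
              with ≡.refl ← ρ-separated k k′ (i , i′ , P.ι-sound eq)
              = ≡.cong (k ,_) (β-injective i i′ (*-cancelˡ (β∈R* (ρ k)) (P.ι-sound eq)))

          r : Fin n′ → Carrier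
          r i = β (ρ (rep i))

          -- The set D = rbA is the dilate of A by `d i`. It depends on i only through `rep i`, so
          -- that a class label suffices to recover it.
          d : Fin n′ → Carrier
          d i = r i * α b

          d∈R* : ∀ i → R* (d i)
          d∈R* i = R*-* (β∈R* _) (α∈R* b)

          -- The triangle inequality along β i β j A, β i b A, β i β l A = r i β k A, r i b A.
          Δ-product : ∀ i j → (Δ (β i * β j) (d i) *ℕ n) *ℕ n ≤ℕ τ *ℕ (τ *ℕ τ)
          Δ-product i j = let k , l , eq = related i in begin
            (Δ (β i * β j) (d i) *ℕ n) *ℕ n
              ≤⟨ ℕ.*-monoˡ-≤ n (Δ-triangle (β i * β j) (d i) (R*-* (β∈R* i) (α∈R* b))) ⟩
            (Δ (β i * β j) (β i * α b) *ℕ Δ (β i * α b) (d i)) *ℕ n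
              ≡⟨ ℕ.*-assoc (Δ (β i * β j) (β i * α b)) _ n ⟩
            Δ (β i * β j) (β i * α b) *ℕ (Δ (β i * α b) (d i) *ℕ n)
              ≤⟨ ℕ.*-mono-≤ (ℕ.≤-trans (Δ-* {β i} refl refl) (Δ≤τ j))
                   (Δ-triangle (β i * α b) (d i) (R*-* (β∈R* _) (β∈R* k))) ⟩
            τ *ℕ (Δ (β i * α b) (r i * β k) *ℕ Δ (r i * β k) (d i))
              ≤⟨ ℕ.*-monoʳ-≤ τ (ℕ.*-mono-≤
                   (ℕ.≤-trans (Δ-sym _ _) (ℕ.≤-trans (Δ-* {β i} eq refl) (Δ≤τ l)))
                   (ℕ.≤-trans (Δ-* {r i} refl refl) (Δ≤τ k))) ⟩
            τ *ℕ (τ *ℕ τ) ∎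
            where open ℕ.≤-Reasoning

          -- Collisions, and the number of differences a₁a₂ - rs.

          triple : Finite (Fin n × Fin n × Fin n) (n *ℕ (n *ℕ n))
          triple = fin n ⊗ fin n ⊗ fin n

          Triple : Set
          Triple = Fin n × Fin n × Fin n

          index₃ : Finite (Fin n′ × Fin n′ × Fin n′) (n′ *ℕ (n′ *ℕ n′))
          index₃ = fin n′ ⊗ fin n′ ⊗ fin n′

          defect : Fin n′ × Fin n′ × Fin n′ → Carrier
          defect (i , j , s) = β i * β j - r i * β s

          abstract
            v : ℕ
            v = ∣ map defect (enum index₃) ∣

            defect-image : Image defect v
            defect-image = image (map-enumerates index₃ defect)

          module V = Image defect-image

          -- With c, c′ the entries at x, x′ and d = `d i`, the two equations rearrange to βᵢβⱼ(c -
          -- c′) = d(α y - α y′) and rᵢβₛ(c - c′) = d(α z - α z′).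
          Collision : Fin n′ × Fin n′ × Fin n′ → Triple × Triple → Set ℓ
          Collision (i , j , s) ((x , y , z) , (x′ , y′ , z′)) =
            differences (β i * β j) (d i) (x , y) ≈ differences (β i * β j) (d i) (x′ , y′) ×
            differences (r i * β s) (d i) (x , z) ≈ differences (r i * β s) (d i) (x′ , z′)

          Regular : Triple × Triple → Set _
          Regular ((x , _) , (x′ , _)) = R* (α x - α x′)

          -- The n³ triples are labelled by a pair of differences, one from βᵢβⱼA - dA and one from
          -- rᵢβₛA - dA, and `collisions` applies. Removing the left factor rᵢ from the second set
          -- leaves βₛA - bA, of size at most τ.
          many-collisions : ∀ i j s →
            (n *ℕ (n *ℕ n)) *ℕ (n *ℕ (n *ℕ n)) ≤ℕ
            (Δ (β i * β j) (d i) *ℕ τ) *ℕ count (triple ⊗ triple) (Collision (i , j , s))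
          many-collisions i j s = begin
            (n *ℕ (n *ℕ n)) *ℕ (n *ℕ (n *ℕ n))
              ≤⟨ collisions triple (fin _ ⊗ fin _) φ ⟩
            (Δ (β i * β j) (d i) *ℕ Δ (r i * β s) (d i)) *ℕ count (triple ⊗ triple) (λ (x , y) → φ x ≡ φ y)
              ≤⟨ ℕ.*-mono-≤ (ℕ.*-monoʳ-≤ (Δ (β i * β j) (d i)) (ℕ.≤-trans (Δ-* {r i} refl refl) (Δ≤τ s)))
                   (count-mono (triple ⊗ triple) (λ _ eq →
                     D.ι-sound _ _ (≡.cong proj₁ eq) , D.ι-sound _ _ (≡.cong proj₂ eq))) ⟩
            (Δ (β i * β j) (d i) *ℕ τ) *ℕ count (triple ⊗ triple) (Collision (i , j , s)) ∎
            where
            open ℕ.≤-Reasoning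
            φ : Triple → Fin (Δ (β i * β j) (d i)) × Fin (Δ (r i * β s) (d i))
            φ (x , y , z) = D.ι (β i * β j) (d i) (x , y) , D.ι (r i * β s) (d i) (x , z)

          -- The value of a zero-divisor difference c - c′ together with c′, y and z determines the
          -- whole collision: c follows at once, and the two equations give y′ and z′ because d
          -- cancels.
          few-irregular : ∀ {Z} (ζ : ∀ x y → ¬ R* (α x - α y) → Fin Z) →
            (∀ x y x′ y′ p p′ → ζ x y p ≡ ζ x′ y′ p′ → α x - α y ≈ α x′ - α y′) →
            ∀ t → count (triple ⊗ triple) (λ s → Collision t s × ¬ Regular s) ≤ℕ Z *ℕ (n *ℕ (n *ℕ n))
          few-irregular {Z} ζ ζ-sound t@(i , j , s) = ℕ.≤-trans
            (count-≤ (triple ⊗ triple) (fin Z ⊗ triple) {Q = λ _ → ⊤} code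
              (λ ((x , y , z) , (x′ , y′ , z′)) (_ , ¬reg) → (ζ x x′ ¬reg , x′ , y , z) , (¬reg , ≡.refl) , tt)
              injective)
            (count≤ (fin Z ⊗ triple) (λ _ → ⊤))
            where
            -- The label `ζ` takes a proof of irregularity, so the code is a relation and not a
            -- function on all pairs of triples.
            code : Triple × Triple → Fin Z × Triple → Set _
            code ((x , y , z) , (x′ , y′ , z′)) w = Σ (¬ R* (α x - α x′)) λ ¬reg → (ζ x x′ ¬reg , x′ , y , z) ≡ w
            injective : ∀ u u′ w → Collision t u × ¬ Regular u → Collision t u′ × ¬ Regular u′ →
                        code u w → code u′ w → u ≡ u′
            injective ((x₁ , y₁ , z₁) , (x₁′ , y₁′ , z₁′)) ((x₂ , y₂ , z₂) , (x₂′ , y₂′ , z₂′)) _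
                      ((p₁ , q₁) , _) ((p₂ , q₂) , _) (¬reg₁ , ≡.refl) (¬reg₂ , eq)
              with eqζ ← ≡.cong proj₁ eq | eq′ ← ≡.cong proj₂ eq
              with ≡.refl ← eq′
              with ≡.refl ← α-injective x₂ x₁ (-‿cancelʳ _ (ζ-sound _ _ _ _ _ _ eqζ))
              with ≡.refl ← α-injective y₁′ y₂′ (*-cancelˡ (d∈R* i) (-‿cancelˡ _ (trans (sym p₁) p₂)))
                 | ≡.refl ← α-injective z₁′ z₂′ (*-cancelˡ (d∈R* i) (-‿cancelˡ _ (trans (sym q₁) q₂)))
              = ≡.refl

          -- Subtracting the two rearranged equations leaves y′ and z only in the combination α y′ +
          -- α z. Recording this sum costs a factor p in place of n².
          regular-value : ∀ t {x y z x′ y′ z′} → Collision t ((x , y , z) , (x′ , y′ , z′)) →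
            defect t * (α x - α x′) ≈ d (proj₁ t) * ((α y + α z′) - (α y′ + α z))
          regular-value (i , j , s) {x} {y} {z} {x′} {y′} {z′} (eq₁ , eq₂) = begin
            defect (i , j , s) * (α x - α x′)
              ≈⟨ [y-z]x≈yx-zx _ _ _ ⟩
            β i * β j * (α x - α x′) - r i * β s * (α x - α x′)
              ≈⟨ -‿cong₂ (exchanged eq₁) (exchanged eq₂) ⟩
            d i * (α y - α y′) - d i * (α z - α z′)
              ≈⟨ x[y-z]≈xy-xz _ _ _ ⟨
            d i * ((α y - α y′) - (α z - α z′))
              ≈⟨ *-congˡ ([w-x]-[y-z]≈[w+z]-[x+y] _ _ _ _) ⟩
            d i * ((α y + α z′) - (α y′ + α z)) ∎
            where
            open import Relation.Binary.Reasoning.Setoid setoid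
            exchanged : ∀ {u v a b a′ b′} → u * a - v * b ≈ u * a′ - v * b′ →
                        u * (a - a′) ≈ v * (b - b′)
            exchanged eq = trans (x[y-z]≈xy-xz _ _ _) (trans (-‿exchange eq) (sym (x[y-z]≈xy-xz _ _ _)))

          -- A defect with one of its regular collisions is coded by the class of i, by x, x′, y, z′
          -- and by the sum α y′ + α z. By `regular-value` the code fixes the defect times the
          -- cancellable c - c′, hence the defect and its chosen indices; the first collision
          -- equation then gives y′, and the sum gives z.
          regular-collisions :
            ∑F (fin v) (λ e → count (triple ⊗ triple) (λ t → Collision (V.σ e) t × Regular t))
              ≤ℕ m *ℕ (n *ℕ (n *ℕ (n *ℕ (n *ℕ p))))
          regular-collisions = begin
            ∑F (fin v) (λ e → count (triple ⊗ triple) (λ t → Collision (V.σ e) t × Regular t))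
              ≡⟨ count-× (fin v) (triple ⊗ triple) _ ⟨
            count (fin v ⊗ triple ⊗ triple) (λ (e , t) → Collision (V.σ e) t × Regular t)
              ≤⟨ count-≤ (fin v ⊗ triple ⊗ triple) (fin m ⊗ fin n ⊗ fin n ⊗ fin n ⊗ fin n ⊗ fin p)
                   {Q = λ _ → ⊤} (λ t w → code t ≡ w) (λ t _ → code t , ≡.refl , tt)
                   (λ t t′ _ h h′ eq eq′ → injective t t′ h h′ (≡.trans eq (≡.sym eq′))) ⟩
            count (fin m ⊗ fin n ⊗ fin n ⊗ fin n ⊗ fin n ⊗ fin p) (λ _ → ⊤)
              ≤⟨ count≤ (fin m ⊗ fin n ⊗ fin n ⊗ fin n ⊗ fin n ⊗ fin p) (λ _ → ⊤) ⟩
            m *ℕ (n *ℕ (n *ℕ (n *ℕ (n *ℕ p)))) ∎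
            where
            open ℕ.≤-Reasoning
            code : Fin v × Triple × Triple → Fin m × Fin n × Fin n × Fin n × Fin n × Fin p
            code (e , (x , y , z) , (x′ , y′ , z′)) = rep (proj₁ (V.σ e)) , x , x′ , y , z′ , S.ι (y′ , z)
            injective : ∀ t t′ → Collision (V.σ (proj₁ t)) (proj₂ t) × Regular (proj₂ t) →
                        Collision (V.σ (proj₁ t′)) (proj₂ t′) × Regular (proj₂ t′) →
                        code t ≡ code t′ → t ≡ t′
            injective (e₁ , (x , y , z₁) , (x′ , y₁′ , z′)) (e₂ , (x₂ , y₂ , z₂) , (x₂′ , y₂′ , z₂′))
                      (coll₁ , reg) (coll₂ , _) eq
              with eq-rep ← ≡.cong proj₁ eq | eq-s ← S.ι-sound (≡.cong (λ w → proj₂ (proj₂ (proj₂ (proj₂ (proj₂ w))))) eq)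
                 | eq-rest ← ≡.cong (λ (_ , a , b , c , d , _) → a , b , c , d) eq
              with ≡.refl ← eq-rest
              with ≡.refl ← V.σ-injective {e₁} {e₂} (*-cancelʳ reg
                   (trans (regular-value (V.σ e₁) coll₁)
                     (trans (*-cong (*-congʳ (reflexive (≡.cong (λ k → β (ρ k)) eq-rep))) (-‿cong₂ refl eq-s))
                       (sym (regular-value (V.σ e₂) coll₂)))))
              with ≡.refl ← α-injective y₁′ y₂′
                     (*-cancelˡ (d∈R* (proj₁ (V.σ e₁))) (-‿cancelˡ _ (trans (sym (proj₁ coll₁)) (proj₁ coll₂))))
              with ≡.refl ← α-injective z₁ z₂ (+-cancelˡ _ _ _ eq-s)
              = ≡.refl

          -- β i β j − β k β l is the telescoping sum of β i β j − r i β s, r i β s − b c,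
          -- b c − r k β t and −(β k β l − r k β t), for arbitrary s, t and c.
          product-differences : ∀ {w} →
            Image {(Fin n′ × Fin n′) × (Fin n′ × Fin n′)} (λ ((i , j) , (k , l)) → β i * β j - β k * β l) w →
            w *ℕ (n′ *ℕ (n′ *ℕ n)) ≤ℕ v *ℕ (m *ℕ (τ *ℕ (τ *ℕ (m *ℕ v))))
          product-differences {w} W = injection-≤
            (fin w ⊗ fin n′ ⊗ fin n′ ⊗ fin n) (fin v ⊗ fin m ⊗ fin τ ⊗ fin τ ⊗ fin m ⊗ fin v) f f-injective
            where
            module W = Image W
            Δ′≤τ : ∀ i → Δ (α b) (β i) ≤ℕ τ
            Δ′≤τ i = ℕ.≤-trans (Δ-sym _ _) (Δ≤τ i)
            -- The number of labels varies with k, so they are all placed in one `Fin τ`. Such a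
            -- label can be read only when k is known, which is why the code also stores `rep i` and
            -- `rep k`.
            left : ∀ k → Fin n′ → Fin n → Fin τ
            left k s c = inject≤ (D.ι (β (ρ k)) (α b) (γ s , c)) (Δ≤τ (ρ k))
            right : ∀ k → Fin n′ → Fin n → Fin τ
            right k t c = inject≤ (D.ι (α b) (β (ρ k)) (c , γ t)) (Δ′≤τ (ρ k))
            left-sound : ∀ {k k′ s s′ c c′} → k ≡ k′ → left k s c ≡ left k′ s′ c′ →
              β (ρ k) * β s - α b * α c ≈ β (ρ k′) * β s′ - α b * α c′
            left-sound ≡.refl eq = D.ι-sound _ _ (inject≤-injective _ _ _ _ eq)
            right-sound : ∀ {k k′ s s′ c c′} → k ≡ k′ → right k s c ≡ right k′ s′ c′ →
              α b * α c - β (ρ k) * β s ≈ α b * α c′ - β (ρ k′) * β s′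
            right-sound ≡.refl eq = D.ι-sound _ _ (inject≤-injective _ _ _ _ eq)
            f : Fin w × Fin n′ × Fin n′ × Fin n → Fin v × Fin m × Fin τ × Fin τ × Fin m × Fin v
            f (e , s , t , c) = let (i , j) , (k , l) = W.σ e in
              V.ι (i , j , s) , rep i , left (rep i) s c , right (rep k) t c , rep k , V.ι (k , l , t)
            sum-of-defects : ∀ a x y z a′ → ((a - x) + ((x - y) + (y - z))) - (a′ - z) ≈ a - a′
            sum-of-defects a x y z a′ = trans
              (-‿cong₂ (trans (+-congˡ (telescope x y z)) (telescope a x z)) refl) ([x-z]-[y-z]≈x-y a a′ z)
            f-injective : ∀ x y → f x ≡ f y → x ≡ y
            f-injective (e , s , t , c) (e′ , s′ , t′ , c′) eq
              with p₁ ← V.ι-sound (≡.cong (λ w → proj₁ w) eq)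
                 | p₂ ← left-sound {s = s} {s′} {c} {c′} (≡.cong (λ w → proj₁ (proj₂ w)) eq) (≡.cong (λ w → proj₁ (proj₂ (proj₂ w))) eq)
                 | p₃ ← right-sound {s = t} {t′} {c} {c′} (≡.cong (λ w → proj₁ (proj₂ (proj₂ (proj₂ (proj₂ w))))) eq)
                          (≡.cong (λ w → proj₁ (proj₂ (proj₂ (proj₂ w)))) eq)
                 | p₄ ← V.ι-sound (≡.cong (λ w → proj₂ (proj₂ (proj₂ (proj₂ (proj₂ w))))) eq)
              -- The four coded differences determine e first; this fixes i, j, k and l, after which
              -- s, t and finally c can be cancelled out.
              with ≡.refl ← W.σ-injective {e} {e′} (trans (sym (sum-of-defects _ _ _ _ _))
                     (trans (-‿cong₂ (+-cong p₁ (+-cong p₂ p₃)) p₄) (sum-of-defects _ _ _ _ _)))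
              with ≡.refl ← β-injective s s′ (*-cancelˡ (β∈R* _) (-‿cancelˡ _ p₁))
                 | ≡.refl ← β-injective t t′ (*-cancelˡ (β∈R* _) (-‿cancelˡ _ p₄))
              with ≡.refl ← α-injective c c′ (*-cancelˡ (α∈R* b) (-‿cancelˡ _ p₂))
              = ≡.refl

-- The estimates with K = M/n, cleared of denominators.

module Arithmetic where
  open import Data.List.Base using ([]; _∷_)
  open import Data.Nat.Base
  open import Data.Nat.Properties
  open import Data.Nat.Tactic.RingSolver using (solve-∀; solve)
  open import Relation.Binary.PropositionalEquality
  open ≤-Reasoning


  -- Absorbs an error term that is at most half of the main term.
  half-≤ : ∀ {a b} → 2 * a ≤ b + a → a ≤ b
  half-≤ {a} {b} 2a≤b+a = +-cancelʳ-≤ a a b (subst (_≤ b + a) (cong (a +_) (+-identityʳ a)) 2a≤b+a)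

  -- Here s is the total energy against b and g the number of popular indices: s ≥ n³/M, while s ≤
  -- ng + n³/(2M).
  popular-size : ∀ {n M q s g} .{{_ : NonZero n}} → q ≤ M →
    (n * n) * (n * n) ≤ q * (n * s) → 2 * (M * s) ≤ 2 * (M * n) * g + n * (n * n) →
    n * n ≤ 2 * (M * g)
  popular-size {n} {M} {q} {s} {g} q≤M energy upper = *-cancelˡ-≤ n (half-≤ (begin
    2 * (n * (n * n))                ≤⟨ *-monoʳ-≤ 2 (*-cancelˡ-≤ n (begin
      n * (n * (n * n))                ≡⟨ *-assoc n n (n * n) ⟨
      (n * n) * (n * n)                ≤⟨ energy ⟩
      q * (n * s)                      ≤⟨ *-monoˡ-≤ (n * s) q≤M ⟩
      M * (n * s)                      ≡⟨ solve (M ∷ n ∷ s ∷ []) ⟩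
      n * (M * s)                      ∎)) ⟩
    2 * (M * s)                      ≤⟨ upper ⟩
    2 * (M * n) * g + n * (n * n)    ≡⟨ cong (_+ n * (n * n)) (solve (M ∷ n ∷ g ∷ [])) ⟩
    n * (2 * (M * g)) + n * (n * n)  ∎))

  dilate-bound : ∀ {n M p d e} → p ≤ M → n * n ≤ 2 * (M * e) → d * e ≤ p * p →
                 d * (n * n) ≤ 2 * (M * (M * M))
  dilate-bound {n} {M} {p} {d} {e} p≤M good de≤ = begin
    d * (n * n)        ≤⟨ *-monoʳ-≤ d good ⟩
    d * (2 * (M * e))  ≡⟨ solve (d ∷ M ∷ e ∷ []) ⟩
    2 * (M * (d * e))  ≤⟨ *-monoʳ-≤ 2 (*-monoʳ-≤ M (≤-trans de≤ (*-mono-≤ p≤M p≤M))) ⟩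
    2 * (M * (M * M))  ∎

  -- In fractions, τ ≤ 2M³/n² and d ≤ τ³/n², so G ≥ n⁶/(dτ) ≥ n⁸/τ⁴ ≥ n¹⁶/(16M¹²).
  collision-bound : ∀ {n M τ d G} → τ * (n * n) ≤ 2 * (M * (M * M)) →
    (d * n) * n ≤ τ * (τ * τ) →
    (n * (n * n)) * (n * (n * n)) ≤ (d * τ) * G →
    n ^ 16 ≤ 16 * M ^ 12 * G
  collision-bound {n} {M} {τ} {d} {G} τ≤ d≤ G≥ = begin
    n ^ 16
      ≡⟨ trans (^-distribˡ-+-* n 8 8) (cong (_* n ^ 8) (eighth n)) ⟩
    (n * (n * n)) * (n * (n * n)) * (n * n) * n ^ 8
      ≤⟨ *-monoˡ-≤ (n ^ 8) (*-monoˡ-≤ (n * n) G≥) ⟩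
    (d * τ) * G * (n * n) * n ^ 8
      ≡⟨ regroup d τ G n (n ^ 8) ⟩
    (d * n * n) * (τ * G * n ^ 8)
      ≤⟨ *-monoˡ-≤ (τ * G * n ^ 8) d≤ ⟩
    τ * (τ * τ) * (τ * G * n ^ 8)
      ≡⟨ cong (λ x → τ * (τ * τ) * (τ * G * x)) (eighth′ n) ⟩
    τ * (τ * τ) * (τ * G * ((n * n) * (n * n) * ((n * n) * (n * n))))
      ≡⟨ regroup′ τ G (n * n) ⟩
    (τ * (n * n)) ^ 4 * G
      ≤⟨ *-monoˡ-≤ G (^-monoˡ-≤ 4 τ≤) ⟩
    (2 * (M * (M * M))) ^ 4 * G
      ≡⟨ cong (_* G) (trans (fourth 2 (M * (M * M))) (cong (16 *_) (twelfth M))) ⟩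
    16 * M ^ 12 * G ∎
    where
    eighth : ∀ n → n * (n * (n * (n * (n * (n * (n * (n * 1))))))) ≡ (n * (n * n)) * (n * (n * n)) * (n * n)
    eighth = solve-∀
    eighth′ : ∀ n → n * (n * (n * (n * (n * (n * (n * (n * 1))))))) ≡ (n * n) * (n * n) * ((n * n) * (n * n))
    eighth′ = solve-∀
    twelfth : ∀ n → (n * (n * n)) * (n * (n * n)) * ((n * (n * n)) * (n * (n * n))) ≡
              n * (n * (n * (n * (n * (n * (n * (n * (n * (n * (n * (n * 1)))))))))))
    twelfth = solve-∀
    regroup : ∀ d τ G n x → (d * τ) * G * (n * n) * x ≡ (d * n * n) * (τ * G * x)
    regroup = solve-∀
    regroup′ : ∀ τ G x → τ * (τ * τ) * (τ * G * (x * x * (x * x))) ≡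
               (τ * x) * ((τ * x) * ((τ * x) * ((τ * x) * 1))) * G
    regroup′ = solve-∀
    fourth : ∀ k x → (k * x) * ((k * x) * ((k * x) * ((k * x) * 1))) ≡ (k * k * (k * k)) * (x * x * (x * x))
    fourth = solve-∀

  -- The irregular collisions are at most half of all as soon as 32M¹²Z ≤ n¹³. The bound on Z is put
  -- with M³² and n³³ so that 32 is both factor and exponent, as the single C of alternative (i)
  -- requires; n ≤ M converts one form to the other.
  regular-bound : ∀ {n M Z g} .{{_ : NonZero n}} → n ≤ M → 32 * M ^ 32 * Z ≤ n * n ^ 32 →
    n ^ 16 ≤ 16 * M ^ 12 * (g + Z * (n * (n * n))) → n ^ 16 ≤ 32 * M ^ 12 * g
  regular-bound {n} {M} {Z} {g} n≤M few many = half-≤ (begin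
    2 * n ^ 16
      ≤⟨ *-monoʳ-≤ 2 many ⟩
    2 * (16 * M ^ 12 * (g + Z * (n * (n * n))))
      ≡⟨ expand (M ^ 12) g Z n ⟩
    32 * M ^ 12 * g + 32 * M ^ 12 * Z * n ^ 3
      ≤⟨ +-monoʳ-≤ (32 * M ^ 12 * g) (*-monoˡ-≤ (n ^ 3) irregular) ⟩
    32 * M ^ 12 * g + n ^ 13 * n ^ 3
      ≡⟨ cong (32 * M ^ 12 * g +_) (sym (^-distribˡ-+-* n 13 3)) ⟩
    32 * M ^ 12 * g + n ^ 16 ∎)
    where
    instance _ = m^n≢0 n 20
    expand : ∀ x g Z n → 2 * (16 * x * (g + Z * (n * (n * n)))) ≡
             32 * x * g + 32 * x * Z * (n * (n * (n * 1)))
    expand = solve-∀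
    regroup : ∀ x y Z → 32 * x * Z * y ≡ 32 * (x * y) * Z
    regroup = solve-∀
    irregular : 32 * M ^ 12 * Z ≤ n ^ 13
    irregular = *-cancelʳ-≤ (32 * M ^ 12 * Z) (n ^ 13) (n ^ 20) (begin
      32 * M ^ 12 * Z * n ^ 20    ≤⟨ *-monoʳ-≤ (32 * M ^ 12 * Z) (^-monoˡ-≤ 20 n≤M) ⟩
      32 * M ^ 12 * Z * M ^ 20    ≡⟨ regroup (M ^ 12) (M ^ 20) Z ⟩
      32 * (M ^ 12 * M ^ 20) * Z  ≡⟨ cong (λ x → 32 * x * Z) (^-distribˡ-+-* M 12 20) ⟨
      32 * M ^ 32 * Z             ≤⟨ few ⟩
      n ^ 33                      ≡⟨ ^-distribˡ-+-* n 13 20 ⟩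
      n ^ 13 * n ^ 20             ∎)

  classes-bound : ∀ {n M n′ q m} → q ≤ M → n * n ≤ 2 * (M * n′) → m * n′ ≤ q →
                  m * (n * n) ≤ 2 * (M * M)
  classes-bound {n} {M} {n′} {q} {m} q≤M large mn′≤q = begin
    m * (n * n)        ≤⟨ *-monoʳ-≤ m large ⟩
    m * (2 * (M * n′)) ≡⟨ solve (m ∷ M ∷ n′ ∷ []) ⟩
    2 * (M * (m * n′)) ≤⟨ *-monoʳ-≤ 2 (*-monoʳ-≤ M (≤-trans mn′≤q q≤M)) ⟩
    2 * (M * M)        ∎

  -- In fractions, v ≤ (32M¹²/n¹⁶)·mn⁴p with m ≤ 2M²/n² and p ≤ M.
  defect-bound : ∀ {n M p m v} .{{_ : NonZero n}} → p ≤ M → m * (n * n) ≤ 2 * (M * M) →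
    v * n ^ 16 ≤ 32 * M ^ 12 * (m * (n * (n * (n * (n * p))))) →
    v * n ^ 14 ≤ 64 * M ^ 15
  defect-bound {n} {M} {p} {m} {v} p≤M m≤ v≤ = *-cancelʳ-≤ (v * n ^ 14) (64 * M ^ 15) (n ^ 4) (begin
    v * n ^ 14 * n ^ 4
      ≡⟨ trans (*-assoc v (n ^ 14) (n ^ 4)) (cong (v *_) (sym (^-distribˡ-+-* n 14 4))) ⟩
    v * n ^ 18
      ≡⟨ trans (cong (v *_) (^-distribˡ-+-* n 16 2)) (sym (*-assoc v (n ^ 16) (n ^ 2))) ⟩
    v * n ^ 16 * n ^ 2
      ≤⟨ *-monoˡ-≤ (n ^ 2) v≤ ⟩
    32 * M ^ 12 * (m * (n * (n * (n * (n * p))))) * n ^ 2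
      ≡⟨ regroup (32 * M ^ 12) m n p ⟩
    32 * M ^ 12 * (m * (n * n) * p) * n ^ 4
      ≤⟨ *-monoˡ-≤ (n ^ 4) (*-monoʳ-≤ (32 * M ^ 12) (*-mono-≤ m≤ p≤M)) ⟩
    32 * M ^ 12 * (2 * (M * M) * M) * n ^ 4
      ≡⟨ cong (_* n ^ 4) (collect 32 2 (M ^ 12) M) ⟩
    64 * (M ^ 12 * M ^ 3) * n ^ 4
      ≡⟨ cong (λ x → 64 * x * n ^ 4) (^-distribˡ-+-* M 12 3) ⟨
    64 * M ^ 15 * n ^ 4 ∎)
    where
    instance _ = m^n≢0 n 4
    regroup : ∀ x m n p → x * (m * (n * (n * (n * (n * p))))) * (n * (n * 1)) ≡
              x * (m * (n * n) * p) * (n * (n * (n * (n * 1))))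
    regroup = solve-∀
    collect : ∀ a b x M → a * x * (b * (M * M) * M) ≡ a * b * (x * (M * (M * (M * 1))))
    collect = solve-∀

  -- The bounds on v, m and τ give v²m²τ² ≤ 2¹⁶M⁴⁰/n³⁶. To end with a multiple of n′, the
  -- denominator n′² is treated as 1/n′² = n′/n′³ ≤ 8M³n′/n⁶, whence 2¹⁹ and 43.
  product-bound : ∀ {n M n′ m v τ w} → n * n ≤ 2 * (M * n′) →
    m * (n * n) ≤ 2 * (M * M) → τ * (n * n) ≤ 2 * (M * (M * M)) → v * n ^ 14 ≤ 64 * M ^ 15 →
    w * (n′ * (n′ * n)) ≤ v * (m * (τ * (τ * (m * v)))) →
    w * n ^ 43 ≤ 2 ^ 19 * M ^ 43 * n′
  product-bound {n} {M} {n′} {m} {v} {τ} {w} large m≤ τ≤ v≤ w≤ = begin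
    w * n ^ 43
      ≡⟨ cong (w *_) (^-distribˡ-+-* n 6 37) ⟩
    w * (n ^ 6 * n ^ 37)
      ≡⟨ cong (λ x → w * (x * n ^ 37)) (^-*-assoc n 2 3) ⟨
    w * ((n ^ 2) ^ 3 * n ^ 37)
      ≤⟨ *-monoʳ-≤ w (*-monoˡ-≤ (n ^ 37) (^-monoˡ-≤ 3
           (subst (_≤ 2 * (M * n′)) (cong (n *_) (sym (*-identityʳ n))) large))) ⟩
    w * ((2 * (M * n′)) ^ 3 * n ^ 37)
      ≡⟨ cong (λ x → w * ((2 * (M * n′)) ^ 3 * x)) (^-distribˡ-+-* n 1 36) ⟩
    w * ((2 * (M * n′)) ^ 3 * (n ^ 1 * n ^ 36))
      ≡⟨ cube 2 w M n′ n (n ^ 36) ⟩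
    (w * (n′ * (n′ * n))) * (8 * M ^ 3 * n′) * n ^ 36
      ≤⟨ *-monoˡ-≤ (n ^ 36) (*-monoˡ-≤ (8 * M ^ 3 * n′) w≤) ⟩
    v * (m * (τ * (τ * (m * v)))) * (8 * M ^ 3 * n′) * n ^ 36
      ≡⟨ cong (v * (m * (τ * (τ * (m * v)))) * (8 * M ^ 3 * n′) *_)
           (trans (^-distribˡ-+-* n 8 28) (cong (n ^ 8 *_) (^-distribˡ-+-* n 14 14))) ⟩
    v * (m * (τ * (τ * (m * v)))) * (8 * M ^ 3 * n′) * (n ^ 8 * (n ^ 14 * n ^ 14))
      ≡⟨ squares v m τ (8 * M ^ 3 * n′) n (n ^ 14) ⟩
    (v * n ^ 14) ^ 2 * (m * (n * n)) ^ 2 * (τ * (n * n)) ^ 2 * (8 * M ^ 3 * n′)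
      ≤⟨ *-monoˡ-≤ (8 * M ^ 3 * n′)
           (*-mono-≤ (*-mono-≤ (^-monoˡ-≤ 2 v≤) (^-monoˡ-≤ 2 m≤)) (^-monoˡ-≤ 2 τ≤)) ⟩
    (64 * M ^ 15) ^ 2 * (2 * (M * M)) ^ 2 * (2 * (M * (M * M))) ^ 2 * (8 * M ^ 3 * n′)
      ≡⟨ trans (collect 64 2 8 (M ^ 15) (M * M) (M * (M * M)) (M ^ 3) n′)
           (cong (λ x → 2 ^ 19 * (M ^ 15 * M ^ 15 * x) * n′) (thirteenth M)) ⟩
    2 ^ 19 * ((M ^ 15 * M ^ 15) * M ^ 13) * n′
      ≡⟨ cong (λ x → 2 ^ 19 * x * n′) (trans (^-distribˡ-+-* M 30 13) (cong (_* M ^ 13) (^-distribˡ-+-* M 15 15))) ⟨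
    2 ^ 19 * M ^ 43 * n′ ∎
    where
    cube : ∀ k w M n′ n x →
           w * ((k * (M * n′)) * ((k * (M * n′)) * ((k * (M * n′)) * 1)) * ((n * 1) * x)) ≡
           (w * (n′ * (n′ * n))) * (k * k * k * (M * (M * (M * 1))) * n′) * x
    cube = solve-∀
    squares : ∀ v m τ k n x →
              v * (m * (τ * (τ * (m * v)))) * k * ((n * (n * (n * (n * (n * (n * (n * (n * 1)))))))) * (x * x)) ≡
              ((v * x) * ((v * x) * 1)) * ((m * (n * n)) * ((m * (n * n)) * 1)) *
              ((τ * (n * n)) * ((τ * (n * n)) * 1)) * k
    squares = solve-∀
    collect : ∀ a b c x y z u n′ →
              ((a * x) * ((a * x) * 1)) * ((b * y) * ((b * y) * 1)) * ((b * z) * ((b * z) * 1)) * (c * u * n′) ≡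
              (a * a * (b * b) * (b * b) * c) * ((x * x) * (y * y * (z * z) * u)) * n′
    collect = solve-∀
    thirteenth : ∀ M → (M * M) * (M * M) * ((M * (M * M)) * (M * (M * M))) * (M * (M * (M * 1))) ≡
                 M * (M * (M * (M * (M * (M * (M * (M * (M * (M * (M * (M * (M * 1))))))))))))
    thirteenth = solve-∀

-- The dichotomy for cardinalities in ℕ.

module NaturalDichotomy where
  open import Algebra.Bundles using (RingWithoutOne)
  open import Axiom.ExcludedMiddle using (ExcludedMiddle)
  open import Data.Fin.Base using (Fin)
  open import Data.List.Base using (List; length; map; filter; allFin)
  open import Data.List.Membership.Propositional using (find)
  open import Data.List.Membership.Propositional.Properties using (∈-filter⁻; ∈-filter⁺; ∈-allFin)
  import Data.List.Membership.Setoid as Membership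
  import Data.List.Membership.Setoid.Properties as Membershipₚ
  open import Data.List.Relation.Unary.All using (All)
  open import Data.List.Relation.Unary.Any as Any using (Any)
  import Data.List.Relation.Unary.Any.Properties as Any
  open import Data.Nat.Base using (ℕ; NonZero; _/_; _^_; >-nonZero) renaming (_+_ to _+ℕ_; _*_ to _*ℕ_; _≤_ to _≤ℕ_; _<_ to _<ℕ_)
  open import Data.Nat.DivMod using (m/n*n≤m; m*n/n≡m; /-monoˡ-≤)
  import Data.Nat.Properties as ℕ
  open import Data.Product.Base using (Σ; _×_; _,_; ∃-syntax; proj₁; proj₂)
  open import Data.Sum.Base as Sum using (_⊎_)
  open import Relation.Binary.PropositionalEquality as ≡ using (_≡_)
  open import Relation.Nullary using (¬_; Dec; yes; no)
  open import Relation.Nullary.Decidable using (¬?)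
  open FiniteSums
  open FiniteRingSubsets
  open DilateCounting
  open Arithmetic

  module _ (em : ∀ {a} → ExcludedMiddle a) {c ℓ} (R : RingWithoutOne c ℓ) where
    open RingWithoutOne R
    open FiniteSubsets em R
    open Counting em
    open Sets em R
    open Membership setoid using (_∈_)
    open Finite

    count-split : ∀ {X N p q} (F : Finite X N) (P : X → Set p) (Q : X → Set q) →
                  count F P ≤ℕ count F (λ x → P x × Q x) +ℕ count F (λ x → P x × ¬ Q x)
    count-split F P Q = ℕ.≤-trans (∑-mono (enum F) split) (ℕ.≤-reflexive (∑-+ (enum F) _ _))
      where
      split : ∀ x → ⟦ P x ⟧ ≤ℕ ⟦ P x × Q x ⟧ +ℕ ⟦ P x × ¬ Q x ⟧
      split x with em {P = Q x}
      ... | yes q = ℕ.≤-trans (⟦⟧-mono (_, q)) (ℕ.m≤m+n _ _)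
      ... | no ¬q = ℕ.≤-trans (⟦⟧-mono (_, ¬q)) (ℕ.m≤n+m _ ⟦ P x × Q x ⟧)

    -- Turns a predicate on indices into a list, the form in which the subset A′ is asked for; `γ`
    -- embeds the indices of A′ into those of A.
    restrict : ∀ {k} (A : List Carrier) (G : Fin ∣ A ∣ → Set k) → ∃[ A′ ] A′ ⊆ A ×
      Σ (Fin ∣ A′ ∣ → Fin ∣ A ∣) λ γ → Enumerates (λ i → el A (γ i)) A′ × (∀ i j → γ i ≡ γ j → i ≡ j) ×
             (∀ i → G (γ i)) × count (fin ∣ A ∣) G ≤ℕ ∣ A′ ∣
    restrict A G = A′ ,
      (λ v∈A′ → let j , v≈ , _ = origin v∈A′ in Any.map (trans v≈) (el-∈ A j)) ,
      γ , enumerates , γ-injective , γ-G ,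
      ℕ.≤-trans
        (count-≤ (fin ∣ A ∣) (fin ∣ A′ ∣) {P = G} {Q = λ i → G (γ i)} (λ j i → γ i ≡ j)
          (λ j g → index (member j g) , γ-index j g , γ-G (index (member j g)))
          (λ j j′ i _ _ p q → ≡.trans (≡.sym p) q))
        (count≤ (fin ∣ A′ ∣) (λ i → G (γ i)))
      where
      G? : ∀ j → Dec (G j)
      G? j = em
      A′ : List Carrier
      A′ = map (el A) (filter G? (allFin ∣ A ∣))
      member : ∀ j → G j → el A j ∈ A′
      member j g = Any.map⁺ (Any.map (λ eq → reflexive (≡.cong (el A) eq)) (∈-filter⁺ G? (∈-allFin j) g))
      origin : ∀ {v} → v ∈ A′ → ∃[ j ] v ≈ el A j × G j
      origin v∈A′ =
        let j , j∈filter , v≈ = find (Any.map⁻ v∈A′)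
        in j , v≈ , proj₂ (∈-filter⁻ G? {xs = allFin ∣ A ∣} j∈filter)
      γ : Fin ∣ A′ ∣ → Fin ∣ A ∣
      γ i = proj₁ (origin (el-∈ A′ i))
      γ-el : ∀ i → el A′ i ≈ el A (γ i)
      γ-el i = proj₁ (proj₂ (origin (el-∈ A′ i)))
      γ-G : ∀ i → G (γ i)
      γ-G i = proj₂ (proj₂ (origin (el-∈ A′ i)))
      enumerates : Enumerates (λ i → el A (γ i)) A′
      enumerates = (λ i → Any.map (trans (sym (γ-el i))) (el-∈ A′ i)) ,
                   (λ v∈A′ → index v∈A′ , trans (el-index v∈A′) (γ-el (index v∈A′)))
      γ-injective : ∀ i j → γ i ≡ γ j → i ≡ j
      γ-injective i j eq = el-injective A′ i j
        (trans (γ-el i) (trans (reflexive (≡.cong (el A) eq)) (sym (γ-el j))))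
      γ-index : ∀ j g → γ (index (member j g)) ≡ j
      γ-index j g = el-injective A (γ (index (member j g))) j
        (trans (sym (γ-el (index (member j g)))) (sym (el-index (member j g))))

    module Bounds
      {n p q} (α : Fin n → Carrier) (α-injective : ∀ i j → α i ≈ α j → i ≡ j) (α∈R* : ∀ i → R* (α i))
      (sums : Image {Fin n × Fin n} (λ (i , j) → α i + α j) p)
      (products : Image {Fin n × Fin n} (λ (i , j) → α i * α j) q)
      (M : ℕ) (0<n : 0 <ℕ n) (n≤M : n ≤ℕ M) (p≤M : p ≤ℕ M) (q≤M : q ≤ℕ M)
      where

      open Core.Dilates em R α α-injective α∈R* sums products

      private
        instance
          n≢0 : NonZero n
          n≢0 = >-nonZero 0<n
          n²≢0 : NonZero (n *ℕ n)
          n²≢0 = ℕ.m*n≢0 n n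

      -- The threshold n²/(2M) is half of n²/M, the guaranteed average energy against b.
      Popular : Fin n → Fin n → Set
      Popular b i = n *ℕ n ≤ℕ 2 *ℕ (M *ℕ energy (α i) (α b))

      -- Popular indices contribute at most n each to the total energy, the others less than n²/(2M)
      -- each. The latter make up at most half of the guaranteed n³/M.
      many-popular : ∃[ b ] n *ℕ n ≤ℕ 2 *ℕ (M *ℕ count (fin n) (Popular b))
      many-popular = let b , large = popular-dilate 0<n in b , popular-size q≤M large (upper b)
        where
        open ℕ.≤-Reasoning
        term : ∀ b i → 2 *ℕ (M *ℕ energy (α i) (α b)) ≤ℕ 2 *ℕ (M *ℕ n) *ℕ ⟦ Popular b i ⟧ +ℕ n *ℕ n
        term b i with em {P = Popular b i}
        ... | yes _ = ℕ.≤-trans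
          (ℕ.≤-trans (ℕ.*-monoʳ-≤ 2 (ℕ.*-monoʳ-≤ M (energy≤n (α∈R* i) (α∈R* b))))
                     (ℕ.≤-reflexive (≡.sym (ℕ.*-identityʳ _))))
          (ℕ.m≤m+n _ (n *ℕ n))
        ... | no unpopular = ℕ.≤-trans (ℕ.<⇒≤ (ℕ.≰⇒> unpopular)) (ℕ.m≤n+m _ (2 *ℕ (M *ℕ n) *ℕ 0))
        upper : ∀ b → 2 *ℕ (M *ℕ ∑F (fin n) (λ i → energy (α i) (α b))) ≤ℕ
                2 *ℕ (M *ℕ n) *ℕ count (fin n) (Popular b) +ℕ n *ℕ (n *ℕ n)
        upper b = begin
          2 *ℕ (M *ℕ ∑F (fin n) (λ i → energy (α i) (α b)))
            ≡⟨ ≡.cong (2 *ℕ_) (∑-*ˡ (enum (fin n)) M _) ⟨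
          2 *ℕ ∑F (fin n) (λ i → M *ℕ energy (α i) (α b))
            ≡⟨ ∑-*ˡ (enum (fin n)) 2 _ ⟨
          ∑F (fin n) (λ i → 2 *ℕ (M *ℕ energy (α i) (α b)))
            ≤⟨ ∑-mono (enum (fin n)) (term b) ⟩
          ∑F (fin n) (λ i → 2 *ℕ (M *ℕ n) *ℕ ⟦ Popular b i ⟧ +ℕ n *ℕ n)
            ≡⟨ ∑-+ (enum (fin n)) _ _ ⟩
          ∑F (fin n) (λ i → 2 *ℕ (M *ℕ n) *ℕ ⟦ Popular b i ⟧) +ℕ ∑F (fin n) (λ _ → n *ℕ n)
            ≡⟨ ≡.cong₂ _+ℕ_ (∑-*ˡ (enum (fin n)) (2 *ℕ (M *ℕ n)) (λ i → ⟦ Popular b i ⟧))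
                 (≡.trans (∑-const (enum (fin n)) (n *ℕ n)) (≡.cong (_*ℕ (n *ℕ n)) (length-enum (fin n)))) ⟩
          2 *ℕ (M *ℕ n) *ℕ count (fin n) (Popular b) +ℕ n *ℕ (n *ℕ n) ∎

      module _
        {Z} (ζ : ∀ x y → ¬ R* (α x - α y) → Fin Z)
        (ζ-sound : ∀ x y x′ y′ p p′ → ζ x y p ≡ ζ x′ y′ p′ → α x - α y ≈ α x′ - α y′)
        (few : 32 *ℕ M ^ 32 *ℕ Z ≤ℕ n *ℕ n ^ 32)
        {n′} (γ : Fin n′ → Fin n) (γ-injective : ∀ i j → γ i ≡ γ j → i ≡ j)
        (b : Fin n) (γ-popular : ∀ i → Popular b (γ i)) (large : n *ℕ n ≤ℕ 2 *ℕ (M *ℕ n′))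
        where

        private
          abstract
            -- The bound 2M³/n² rounded down: it has to be a natural number to serve as the size
            -- `Fin τ` of a label set, and rounding keeps it above the integers Δ.
            τ : ℕ
            τ = (2 *ℕ (M *ℕ (M *ℕ M))) / (n *ℕ n)

            τ≤ : τ *ℕ (n *ℕ n) ≤ℕ 2 *ℕ (M *ℕ (M *ℕ M))
            τ≤ = m/n*n≤m _ (n *ℕ n)

            Δ≤τ : ∀ i → Δ (α (γ i)) (α b) ≤ℕ τ
            Δ≤τ i = ℕ.≤-trans (ℕ.≤-reflexive (≡.sym (m*n/n≡m _ (n *ℕ n))))
              (/-monoˡ-≤ (n *ℕ n) (dilate-bound {n} {M} {p} {Δ (α (γ i)) (α b)} p≤M (γ-popular i) (Δ*energy≤ (α (γ i)) (α b))))

          module B = Restricted γ γ-injective b Δ≤τ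

          0<n′ : 0 <ℕ n′
          0<n′ = ℕ.n≢0⇒n>0 λ n′≡0 → ℕ.<⇒≱ (ℕ.*-mono-< 0<n 0<n)
            (ℕ.≤-trans large (ℕ.≤-reflexive (≡.trans (≡.cong (λ k → 2 *ℕ (M *ℕ k)) n′≡0)
              (≡.cong (2 *ℕ_) (ℕ.*-zeroʳ M)))))

          module _ (reps : Representatives B._∼_) where
            open B.Classes reps
            open Representatives reps renaming (size to m)

            m≤ : m *ℕ (n *ℕ n) ≤ℕ 2 *ℕ (M *ℕ M)
            m≤ = classes-bound {n} {M} {n′} {q} {m} q≤M large m*n′≤q

            regular-count : Fin v → ℕ
            regular-count e = count (triple ⊗ triple) (λ t → Collision (V.σ e) t × Regular t)

            many-regular : ∀ e → n ^ 16 ≤ℕ 32 *ℕ M ^ 12 *ℕ regular-count e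
            many-regular e = let i , j , s = V.σ e in
              regular-bound n≤M few (ℕ.≤-trans
                (collision-bound {n} {M} {τ} {Δ (B.β i * B.β j) (d i)} τ≤ (Δ-product i j) (many-collisions i j s))
                (ℕ.*-monoʳ-≤ (16 *ℕ M ^ 12) (ℕ.≤-trans (count-split (triple ⊗ triple) (Collision (V.σ e)) Regular)
                  (ℕ.+-monoʳ-≤ (regular-count e) (few-irregular ζ ζ-sound (V.σ e))))))

            -- Each of the v defects has at least n¹⁶/(32M¹²) regular collisions, and all of them
            -- together have at most mn⁴p.
            v≤ : v *ℕ n ^ 14 ≤ℕ 64 *ℕ M ^ 15
            v≤ = defect-bound {n} {M} {p} {m} {v} p≤M m≤ (begin
              v *ℕ n ^ 16
                ≡⟨ ≡.cong (_*ℕ n ^ 16) (≡.sym (length-enum (fin v))) ⟩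
              length (enum (fin v)) *ℕ n ^ 16
                ≤⟨ ∑-≥const (enum (fin v)) {λ e → 32 *ℕ M ^ 12 *ℕ regular-count e} {n ^ 16} many-regular ⟩
              ∑F (fin v) (λ e → 32 *ℕ M ^ 12 *ℕ regular-count e)
                ≡⟨ ∑-*ˡ (enum (fin v)) (32 *ℕ M ^ 12) regular-count ⟩
              32 *ℕ M ^ 12 *ℕ ∑F (fin v) regular-count
                ≤⟨ ℕ.*-monoʳ-≤ (32 *ℕ M ^ 12) regular-collisions ⟩
              32 *ℕ M ^ 12 *ℕ (m *ℕ (n *ℕ (n *ℕ (n *ℕ (n *ℕ p))))) ∎)
              where open ℕ.≤-Reasoning

            product-differences-bound : ∀ {w} →
              w *ℕ (n′ *ℕ (n′ *ℕ n)) ≤ℕ v *ℕ (m *ℕ (τ *ℕ (τ *ℕ (m *ℕ v)))) →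
              w *ℕ n ^ 43 ≤ℕ 2 ^ 19 *ℕ M ^ 43 *ℕ n′
            product-differences-bound {w} = product-bound {n} {M} {n′} {m} {v} {τ} {w} large m≤ τ≤ v≤

        few-product-differences : ∀ {w} →
          Image {(Fin n′ × Fin n′) × (Fin n′ × Fin n′)}
            (λ ((i , j) , (k , l)) → α (γ i) * α (γ j) - α (γ k) * α (γ l)) w →
          w *ℕ n ^ 43 ≤ℕ 2 ^ 19 *ℕ M ^ 43 *ℕ n′
        few-product-differences {w} W =
          let reps = B.classes 0<n′
          in product-differences-bound reps {w} (B.Classes.product-differences reps W)

    -- The case split compares n³³ with 32M³²Z, where Z counts the zero divisors in A - A. If the
    -- former is at most the latter, this is alternative (i); otherwise the reverse inequality says
    -- that zero divisors are few.
    dichotomy : ∀ A M → 0 <ℕ ∣ A ∣ → All R* A →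
      ∣ A ∣ ≤ℕ M → ∣ A +ˢ A ∣ ≤ℕ M → ∣ A ·ˢ A ∣ ≤ℕ M →
      (∣ A ∣ *ℕ ∣ A ∣ ^ 32 ≤ℕ 32 *ℕ M ^ 32 *ℕ ∣ (A -ˢ A) ∖R* ∣)
      ⊎ (∃[ A′ ] A′ ⊆ A × ∣ A ∣ *ℕ ∣ A ∣ ≤ℕ 2 *ℕ (M *ℕ ∣ A′ ∣)
               × ∣ A′ ·ˢ A′ -ˢ A′ ·ˢ A′ ∣ *ℕ ∣ A ∣ ^ 43 ≤ℕ 2 ^ 19 *ℕ M ^ 43 *ℕ ∣ A′ ∣)
    dichotomy A M 0<n A⊆R* n≤M p≤M q≤M =
      Sum.map₂ good-subset (ℕ.≤-total (∣ A ∣ *ℕ ∣ A ∣ ^ 32) (32 *ℕ M ^ 32 *ℕ ∣ (A -ˢ A) ∖R* ∣))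
      where
      open Bounds (el A) (el-injective A) (el-All A A⊆R*)
        (image (cartesianProductWith-enumerates _+_ +-cong (el-enumerates A) (el-enumerates A)))
        (image (cartesianProductWith-enumerates _*_ *-cong (el-enumerates A) (el-enumerates A)))
        M 0<n n≤M p≤M q≤M
      ζ : ∀ x y → ¬ R* (el A x - el A y) → Fin ∣ (A -ˢ A) ∖R* ∣
      ζ x y irregular = index (Membershipₚ.∈-filter⁺ setoid (λ r → ¬? (em {P = R* r}))
        (λ r≈s ¬r s∈R* → ¬r (R*-resp-≈ (sym r≈s) s∈R*))
        (proj₁ (cartesianProductWith-enumerates _-_ -‿cong₂ (el-enumerates A) (el-enumerates A)) (x , y))
        irregular)
      good-subset : 32 *ℕ M ^ 32 *ℕ ∣ (A -ˢ A) ∖R* ∣ ≤ℕ ∣ A ∣ *ℕ ∣ A ∣ ^ 32 →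
        ∃[ A′ ] A′ ⊆ A × ∣ A ∣ *ℕ ∣ A ∣ ≤ℕ 2 *ℕ (M *ℕ ∣ A′ ∣)
               × ∣ A′ ·ˢ A′ -ˢ A′ ·ˢ A′ ∣ *ℕ ∣ A ∣ ^ 43 ≤ℕ 2 ^ 19 *ℕ M ^ 43 *ℕ ∣ A′ ∣
      good-subset few =
       let b , many = many-popular
           A′ , A′⊆A , γ , γ-enumerates , γ-injective , γ-popular , ≤n′ = restrict A (Popular b)
           large = ℕ.≤-trans many (ℕ.*-monoʳ-≤ 2 (ℕ.*-monoʳ-≤ M ≤n′))
           products′ = cartesianProductWith-enumerates _*_ *-cong γ-enumerates γ-enumerates
       in A′ , A′⊆A , large ,
           few-product-differences {Z = ∣ (A -ˢ A) ∖R* ∣} ζ (λ _ _ _ _ _ _ → index-injective _ _) few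
             γ γ-injective b γ-popular large
             {∣ A′ ·ˢ A′ -ˢ A′ ·ˢ A′ ∣} (image (cartesianProductWith-enumerates _-_ -‿cong₂ products′ products′))

-- Transfer from natural numbers to Cauchy reals.

module RealBounds where
  open import Data.Integer.Base as ℤ using (+_)
  import Data.Integer.Properties as ℤ
  open import Data.Nat.Base as ℕ using (ℕ; zero; suc)
  import Data.Nat.Properties as ℕ
  open import Data.Product.Base using (_×_; _,_; ∃-syntax; proj₁; proj₂)
  open import Data.Rational.Base as ℚ using (ℚ; 0ℚ; 1ℚ; _/_; _+_; _*_; _-_; _≤_; _<_; Positive)
  import Data.Rational.Properties as ℚ
  open import Data.Rational.Solver using (module +-*-Solver)
  open import Data.Rational.Unnormalised.Base as ℚᵘ using (mkℚᵘ; *≤*)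
  import Data.Rational.Unnormalised.Properties as ℚᵘ
  open import Data.Sum.Base using (inj₁; inj₂)
  open import Relation.Binary.PropositionalEquality

  ι : ℕ → ℚ
  ι a = + a / 1

  ι-* : ∀ a b → ι (a ℕ.* b) ≡ ι a * ι b
  ι-* a b = ℚ.toℚᵘ-injective (begin
    ℚ.toℚᵘ (ι (a ℕ.* b))           ≈⟨ ℚ.toℚᵘ-fromℚᵘ (mkℚᵘ (+ (a ℕ.* b)) 0) ⟩
    mkℚᵘ (+ (a ℕ.* b)) 0           ≡⟨ cong (λ z → mkℚᵘ z 0) (ℤ.pos-* a b) ⟩
    mkℚᵘ (+ a) 0 ℚᵘ.* mkℚᵘ (+ b) 0 ≈⟨ ℚᵘ.*-cong (ℚ.toℚᵘ-fromℚᵘ (mkℚᵘ (+ a) 0)) (ℚ.toℚᵘ-fromℚᵘ (mkℚᵘ (+ b) 0)) ⟨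
    ℚ.toℚᵘ (ι a) ℚᵘ.* ℚ.toℚᵘ (ι b) ≈⟨ ℚ.toℚᵘ-homo-* (ι a) (ι b) ⟨
    ℚ.toℚᵘ (ι a * ι b)             ∎)
    where open ℚᵘ.≃-Reasoning

  ι-mono : ∀ {a b} → a ℕ.≤ b → ι a ≤ ι b
  ι-mono {a} {b} a≤b = ℚ.toℚᵘ-cancel-≤ (begin
    ℚ.toℚᵘ (ι a)  ≃⟨ ℚ.toℚᵘ-fromℚᵘ (mkℚᵘ (+ a) 0) ⟩
    mkℚᵘ (+ a) 0  ≤⟨ *≤* (ℤ.*-monoʳ-≤-nonNeg (+ 1) (ℤ.+≤+ a≤b)) ⟩
    mkℚᵘ (+ b) 0  ≃⟨ ℚ.toℚᵘ-fromℚᵘ (mkℚᵘ (+ b) 0) ⟨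
    ℚ.toℚᵘ (ι b)  ∎)
    where open ℚᵘ.≤-Reasoning

  ι-positive : ∀ {a} → 0 ℕ.< a → Positive (ι a)
  ι-positive 0<a = ℚ.positive (ℚ.<-≤-trans (ℚ.positive⁻¹ 1ℚ) (ι-mono 0<a))

  p≤q+r : ∀ {p q r} → p ≤ q → 0ℚ < r → p ≤ q + r
  p≤q+r {p} p≤q 0<r = ℚ.≤-trans (ℚ.≤-reflexive (sym (ℚ.+-identityʳ p))) (ℚ.+-mono-≤ p≤q (ℚ.<⇒≤ 0<r))

  ≤ᴿ-refl : ∀ q → fromℚ q ≤ᴿ fromℚ q
  ≤ᴿ-refl q ε 0<ε = 0 , λ _ _ → p≤q+r (ℚ.≤-refl {q}) 0<ε

  *-mono-pos : ∀ {p q x y} → 0ℚ ≤ p → 0ℚ ≤ q → p ≤ x → q ≤ y → p * q ≤ x * y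
  *-mono-pos {p} {q} {x} {y} 0≤p 0≤q p≤x q≤y = ℚ.≤-trans
    (ℚ.*-monoʳ-≤-nonNeg q {{ℚ.nonNegative 0≤q}} p≤x)
    (ℚ.*-monoˡ-≤-nonNeg x {{ℚ.nonNegative (ℚ.≤-trans 0≤p p≤x)}} q≤y)

  p≤q+r⇒p-r≤q : ∀ {p q} r → p ≤ q + r → p - r ≤ q
  p≤q+r⇒p-r≤q {p} {q} r p≤q+r = ℚ.≤-trans (ℚ.+-monoˡ-≤ (ℚ.- r) p≤q+r) (ℚ.≤-reflexive (cancel q r))
    where
    open +-*-Solver
    cancel : ∀ q r → (q + r) - r ≡ q
    cancel = solve 2 (λ q r → (q :+ r) :- r := q) refl

  -- Positivity matters: for δ ≤ r, s the bounds r − δ ≤ x and s − δ ≤ y may be multiplied.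
  *ᴿ-lower : ∀ {r s x y} → Positive r → Positive s → fromℚ r ≤ᴿ x → fromℚ s ≤ᴿ y →
             fromℚ (r * s) ≤ᴿ x *ᴿ y
  *ᴿ-lower {r} {s} {x} {y} r>0 s>0 r≤x s≤y ε 0<ε = N₁ ℕ.⊔ N₂ , bound
    where
    instance
      T>0 : Positive (r + s)
      T>0 = ℚ.positive (ℚ.+-mono-< (ℚ.positive⁻¹ r {{r>0}}) (ℚ.positive⁻¹ s {{s>0}}))
      T≢0 : ℚ.NonZero (r + s)
      T≢0 = ℚ.pos⇒nonZero (r + s)
      T⁻¹>0 : Positive (ℚ.1/ (r + s))
      T⁻¹>0 = ℚ.1/pos⇒pos (r + s)
    δ₀ δ : ℚ
    δ₀ = ε * ℚ.1/ (r + s)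
    -- The third bound, δ ≤ ε/(r + s), makes the loss rs - (r - δ)(s - δ) at most ε.
    δ = (r ℚ.⊓ s) ℚ.⊓ δ₀
    0<⊓ : ∀ {p q} → 0ℚ < p → 0ℚ < q → 0ℚ < p ℚ.⊓ q
    0<⊓ {p} {q} 0<p 0<q with ℚ.⊓-sel p q
    ... | inj₁ eq = subst (0ℚ <_) (sym eq) 0<p
    ... | inj₂ eq = subst (0ℚ <_) (sym eq) 0<q
    0<δ : 0ℚ < δ
    0<δ = 0<⊓ (0<⊓ (ℚ.positive⁻¹ r {{r>0}}) (ℚ.positive⁻¹ s {{s>0}}))
      (ℚ.positive⁻¹ δ₀ {{ℚ.pos*pos⇒pos ε {{ℚ.positive 0<ε}} (ℚ.1/ (r + s))}})
    δ≤r : δ ≤ r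
    δ≤r = ℚ.≤-trans (ℚ.p⊓q≤p (r ℚ.⊓ s) δ₀) (ℚ.p⊓q≤p r s)
    δ≤s : δ ≤ s
    δ≤s = ℚ.≤-trans (ℚ.p⊓q≤p (r ℚ.⊓ s) δ₀) (ℚ.p⊓q≤q r s)
    δT≤ε : δ * (r + s) ≤ ε
    δT≤ε = begin
      δ * (r + s)                    ≤⟨ ℚ.*-monoʳ-≤-nonNeg (r + s) {{ℚ.pos⇒nonNeg (r + s)}} (ℚ.p⊓q≤q (r ℚ.⊓ s) δ₀) ⟩
      ε * ℚ.1/ (r + s) * (r + s)     ≡⟨ ℚ.*-assoc ε (ℚ.1/ (r + s)) (r + s) ⟩
      ε * (ℚ.1/ (r + s) * (r + s))   ≡⟨ cong (ε *_) (ℚ.*-inverseˡ (r + s)) ⟩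
      ε * 1ℚ                         ≡⟨ ℚ.*-identityʳ ε ⟩
      ε                              ∎
      where open ℚ.≤-Reasoning
    N₁ N₂ : ℕ
    N₁ = proj₁ (r≤x δ 0<δ)
    N₂ = proj₁ (s≤y δ 0<δ)
    0≤-δ : ∀ {t} → δ ≤ t → 0ℚ ≤ t - δ
    0≤-δ {t} δ≤t = ℚ.≤-trans (ℚ.≤-reflexive (sym (ℚ.+-inverseʳ δ))) (ℚ.+-monoˡ-≤ (ℚ.- δ) δ≤t)
    expand : ∀ r s δ → r * s + δ * δ ≡ (r - δ) * (s - δ) + δ * (r + s)
    expand = solve 3 (λ r s δ → r :* s :+ δ :* δ := (r :- δ) :* (s :- δ) :+ δ :* (r :+ s)) refl
      where open +-*-Solver
    bound : ∀ k → N₁ ℕ.⊔ N₂ ℕ.≤ k → r * s ≤ seq x k * seq y k + ε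
    bound k N≤k = begin
      r * s                              ≤⟨ p≤q+r ℚ.≤-refl (ℚ.positive⁻¹ (δ * δ)
        {{ℚ.pos*pos⇒pos δ {{ℚ.positive 0<δ}} δ {{ℚ.positive 0<δ}}}}) ⟩
      r * s + δ * δ                      ≡⟨ expand r s δ ⟩
      (r - δ) * (s - δ) + δ * (r + s)    ≤⟨ ℚ.+-mono-≤
        (*-mono-pos {r - δ} {s - δ} {seq x k} {seq y k} (0≤-δ δ≤r) (0≤-δ δ≤s)
          (p≤q+r⇒p-r≤q δ (proj₂ (r≤x δ 0<δ) k (ℕ.≤-trans (ℕ.m≤m⊔n N₁ N₂) N≤k)))
          (p≤q+r⇒p-r≤q δ (proj₂ (s≤y δ 0<δ) k (ℕ.≤-trans (ℕ.m≤n⊔m N₁ N₂) N≤k))))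
        δT≤ε ⟩
      seq x k * seq y k + ε              ∎
      where open ℚ.≤-Reasoning

  infixr 8 _^ℚ_
  _^ℚ_ : ℚ → ℕ → ℚ
  q ^ℚ zero  = 1ℚ
  q ^ℚ suc e = q * q ^ℚ e

  ^ℚ-positive : ∀ {q} → Positive q → ∀ e → Positive (q ^ℚ e)
  ^ℚ-positive q>0 zero    = _
  ^ℚ-positive {q} q>0 (suc e) = ℚ.pos*pos⇒pos q {{q>0}} (q ^ℚ e) {{^ℚ-positive q>0 e}}

  ^ᴿ-lower : ∀ {q K} → Positive q → fromℚ q ≤ᴿ K → ∀ e → fromℚ (q ^ℚ e) ≤ᴿ K ^ᴿ e
  ^ᴿ-lower q>0 q≤K zero = ≤ᴿ-refl 1ℚ
  ^ᴿ-lower {q} {K} q>0 q≤K (suc e) =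
    *ᴿ-lower {q} {q ^ℚ e} {K} {K ^ᴿ e} q>0 (^ℚ-positive q>0 e) q≤K (^ᴿ-lower q>0 q≤K e)

  ^ℚ-ι : ∀ {q n M} → q * ι n ≡ ι M → ∀ e → q ^ℚ e * ι (n ℕ.^ e) ≡ ι (M ℕ.^ e)
  ^ℚ-ι eq zero = refl
  ^ℚ-ι {q} {n} {M} eq (suc e) = begin
    q * q ^ℚ e * ι (n ℕ.* n ℕ.^ e)        ≡⟨ cong (q * q ^ℚ e *_) (ι-* n (n ℕ.^ e)) ⟩
    q * q ^ℚ e * (ι n * ι (n ℕ.^ e))      ≡⟨ interchange q (q ^ℚ e) (ι n) (ι (n ℕ.^ e)) ⟩
    (q * ι n) * (q ^ℚ e * ι (n ℕ.^ e))    ≡⟨ cong₂ _*_ eq (^ℚ-ι eq e) ⟩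
    ι M * ι (M ℕ.^ e)                     ≡⟨ ι-* M (M ℕ.^ e) ⟨
    ι (M ℕ.* M ℕ.^ e)                     ∎
    where
    open ≡-Reasoning
    interchange : ∀ a b c d → a * b * (c * d) ≡ (a * c) * (b * d)
    interchange = solve 4 (λ a b c d → a :* b :* (c :* d) := (a :* c) :* (b :* d)) refl
      where open +-*-Solver

  -- The rational M/n lies below K, so powers of K can be bounded from below by powers of an
  -- explicit fraction, without dividing reals.
  ratio-lower : ∀ {n M K} → 0 ℕ.< n → 0 ℕ.< M → fromℕ M ≤ᴿ K *ᴿ fromℕ n →
                ∃[ q ] Positive q × q * ι n ≡ ι M × fromℚ q ≤ᴿ K
  ratio-lower {n} {M} {K} 0<n 0<M M≤Kn = q , q>0 , eq , lower
    where
    instance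
      n>0 : Positive (ι n)
      n>0 = ι-positive 0<n
      M>0 : Positive (ι M)
      M>0 = ι-positive 0<M
      n≢0 : ℚ.NonZero (ι n)
      n≢0 = ℚ.pos⇒nonZero (ι n)
      n⁻¹>0 : Positive (ℚ.1/ ι n)
      n⁻¹>0 = ℚ.1/pos⇒pos (ι n)
    q = ι M * ℚ.1/ ι n
    q>0 : Positive q
    q>0 = ℚ.pos*pos⇒pos (ι M) (ℚ.1/ ι n)
    eq : q * ι n ≡ ι M
    eq = trans (ℚ.*-assoc (ι M) (ℚ.1/ ι n) (ι n))
      (trans (cong (ι M *_) (ℚ.*-inverseˡ (ι n))) (ℚ.*-identityʳ (ι M)))
    lower : fromℚ q ≤ᴿ K
    lower ε 0<ε =
      let N , bound = M≤Kn (ε * ι n) (ℚ.positive⁻¹ (ε * ι n) {{ℚ.pos*pos⇒pos ε {{ℚ.positive 0<ε}} (ι n)}})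
      in N , λ k N≤k → ℚ.*-cancelʳ-≤-pos (ι n) (begin
        q * ι n                    ≡⟨ eq ⟩
        ι M                        ≤⟨ bound k N≤k ⟩
        seq K k * ι n + ε * ι n    ≡⟨ ℚ.*-distribʳ-+ (ι n) (seq K k) ε ⟨
        (seq K k + ε) * ι n        ∎)
      where open ℚ.≤-Reasoning

  -- Restores the denominators: applied with q = (M/n)ᵉ, N = nᵉ, D = Mᵉ and x = Kᵉ. The factors c, q
  -- and k are positive so that `*ᴿ-lower` applies.
  scaled-lower : ∀ {a c k D N q} x → 0 ℕ.< c → 0 ℕ.< k → 0 ℕ.< N →
                 Positive q → q * ι N ≡ ι D → fromℚ q ≤ᴿ x →
                 a ℕ.* N ℕ.≤ c ℕ.* D ℕ.* k → fromℕ a ≤ᴿ fromℕ c *ᴿ x *ᴿ fromℕ k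
  scaled-lower {a} {c} {k} {D} {N} {q} x 0<c 0<k 0<N q>0 eq q≤x a≤ ε 0<ε =
    let N₀ , bound = *ᴿ-lower {ι c * q} {ι k} {fromℕ c *ᴿ x} {fromℕ k} cq>0 (ι-positive 0<k)
                       (*ᴿ-lower {ι c} {q} {fromℕ c} {x} (ι-positive 0<c) q>0 (≤ᴿ-refl (ι c)) q≤x)
                       (≤ᴿ-refl (ι k)) ε 0<ε
    in N₀ , λ j N₀≤j → ℚ.≤-trans a≤cqk (bound j N₀≤j)
    where
    open ℚ.≤-Reasoning
    cq>0 : Positive (ι c * q)
    cq>0 = ℚ.pos*pos⇒pos (ι c) {{ι-positive 0<c}} q {{q>0}}
    regroup : ∀ c q k n → c * (q * n) * k ≡ c * q * k * n
    regroup = solve 4 (λ c q k n → c :* (q :* n) :* k := c :* q :* k :* n) refl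
      where open +-*-Solver
    a≤cqk : ι a ≤ ι c * q * ι k
    a≤cqk = ℚ.*-cancelʳ-≤-pos (ι N) {{ι-positive 0<N}} (begin
      ι a * ι N                ≡⟨ ι-* a N ⟨
      ι (a ℕ.* N)              ≤⟨ ι-mono a≤ ⟩
      ι (c ℕ.* D ℕ.* k)        ≡⟨ trans (ι-* (c ℕ.* D) k) (cong (_* ι k) (ι-* c D)) ⟩
      ι c * ι D * ι k          ≡⟨ cong (λ z → ι c * z * ι k) eq ⟨
      ι c * (q * ι N) * ι k    ≡⟨ regroup (ι c) q (ι k) (ι N) ⟩
      ι c * q * ι k * ι N      ∎)

  self≤scaled : ∀ {K n} → 0 ℕ.< n → fromℕ 1 ≤ᴿ K → fromℕ n ≤ᴿ K *ᴿ fromℕ n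
  self≤scaled {K} {n} 0<n 1≤K = subst (λ q → fromℚ q ≤ᴿ K *ᴿ fromℕ n) (ℚ.*-identityˡ (ι n))
    (*ᴿ-lower {1ℚ} {ι n} {K} {fromℕ n} _ (ι-positive 0<n) 1≤K (≤ᴿ-refl (ι n)))

-- Choice of M and passage to the real K.

module Assembly (em : ∀ {a} → ExcludedMiddle a) {c ℓ} (R : RingWithoutOne c ℓ) where
  open import Data.Empty using (⊥-elim)
  open import Data.List.Base using (_∷_)
  open import Data.Nat.Base using (ℕ; suc; z≤n; s≤s) renaming (_⊔_ to _⊔ℕ_; _≤_ to _≤ℕ_; _<_ to _<ℕ_; _*_ to _*ℕ_; _^_ to _^ℕ_)
  import Data.Nat.Properties as ℕ
  open import Data.Product.Base using (_,_)
  open import Data.Sum.Base as Sum using (inj₁; inj₂)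
  open import Relation.Binary.PropositionalEquality using (refl; sym; subst)
  open RingWithoutOne R using (Carrier)
  open FiniteSubsets em R
  open RealBounds

  nonempty : ∀ A → A ≢ [] → 0 <ℕ ∣ A ∣
  nonempty []      A≢[] = ⊥-elim (A≢[] refl)
  nonempty (_ ∷ _) _    = s≤s z≤n

  -- Supplies the positivity of Z and |A′| that `scaled-lower` asks for.
  positive-factor : ∀ {m k} n → 0 <ℕ m → m ≤ℕ n *ℕ k → 0 <ℕ k
  positive-factor {m} {0}     n 0<m m≤ = ⊥-elim (ℕ.<⇒≱ 0<m (subst (m ≤ℕ_) (ℕ.*-zeroʳ n) m≤))
  positive-factor {m} {suc _} n 0<m m≤ = s≤s z≤n

  0<^ : ∀ {n} → 0 <ℕ n → ∀ e → 0 <ℕ n ^ℕ e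
  0<^ {suc n} _ e = ℕ.m^n>0 (suc n) e

  ⊔-elim : ∀ {p} (P : ℕ → Set p) a b → P a → P b → P (a ⊔ℕ b)
  ⊔-elim P a b pa pb with ℕ.⊔-sel a b
  ... | inj₁ eq = subst P (sym eq) pa
  ... | inj₂ eq = subst P (sym eq) pb

  katz-tao : (A : List Carrier) (K : ℝ) → A ≢ [] → All R* A →
    fromℕ 1 ≤ᴿ K →
    fromℕ ∣ A +ˢ A ∣ ≤ᴿ K *ᴿ fromℕ ∣ A ∣ →
    fromℕ ∣ A ·ˢ A ∣ ≤ᴿ K *ᴿ fromℕ ∣ A ∣ →
    (fromℕ ∣ A ∣ ≤ᴿ fromℕ 32 *ᴿ K ^ᴿ 32 *ᴿ fromℕ ∣ (A -ˢ A) ∖R* ∣)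
    ⊎
    (∃[ A′ ] A′ ⊆ A
           × (fromℕ ∣ A ∣ ≤ᴿ fromℕ 2 *ᴿ K *ᴿ fromℕ ∣ A′ ∣)
           × (fromℕ ∣ A′ ·ˢ A′ -ˢ A′ ·ˢ A′ ∣
                ≤ᴿ fromℕ 524288 *ᴿ K ^ᴿ 43 *ᴿ fromℕ ∣ A′ ∣))
  katz-tao A K A≢[] A⊆R* 1≤K sums≤ products≤ =
    let q , q>0 , eq , q≤K = ratio-lower {n} {M} {K} 0<n 0<M M≤Kn
        n^e>0 = 0<^ {n} 0<n
        q^e>0 = ^ℚ-positive {q} q>0
        q^e≤K^e = ^ᴿ-lower {q} {K} q>0 q≤K
        powers = ^ℚ-ι {q} {n} {M} eq
    in Sum.map
      (λ many → scaled-lower {n} {32} {Z} {M ^ℕ 32} {n ^ℕ 32} {q ^ℚ 32} (K ^ᴿ 32)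
        (s≤s z≤n) (positive-factor {n *ℕ n ^ℕ 32} {Z} (32 *ℕ M ^ℕ 32) (ℕ.*-mono-< 0<n (n^e>0 32)) many)
        (n^e>0 32) (q^e>0 32) (powers 32) (q^e≤K^e 32) many)
      (λ (A′ , A′⊆A , large , few) →
        let n′ = ∣ A′ ∣
            w = ∣ A′ ·ˢ A′ -ˢ A′ ·ˢ A′ ∣
            large′ = ℕ.≤-trans large (ℕ.≤-reflexive (sym (ℕ.*-assoc 2 M n′)))
            0<n′ = positive-factor {n *ℕ n} {n′} (2 *ℕ M) (ℕ.*-mono-< 0<n 0<n) large′
        in A′ , A′⊆A ,
           scaled-lower {n} {2} {n′} {M} {n} {q} K (s≤s z≤n) 0<n′ 0<n q>0 eq q≤K large′ ,
           -- The factor 524288 is 2¹⁹.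
           scaled-lower {w} {524288} {n′} {M ^ℕ 43} {n ^ℕ 43} {q ^ℚ 43} (K ^ᴿ 43)
             (s≤s z≤n) 0<n′ (n^e>0 43) (q^e>0 43) (powers 43) (q^e≤K^e 43) few)
      (NaturalDichotomy.dichotomy em R A M 0<n A⊆R* (ℕ.m≤m⊔n n (p ⊔ℕ r))
        (ℕ.≤-trans (ℕ.m≤m⊔n p r) (ℕ.m≤n⊔m n (p ⊔ℕ r)))
        (ℕ.≤-trans (ℕ.m≤n⊔m p r) (ℕ.m≤n⊔m n (p ⊔ℕ r))))
    where
    n p r M Z : ℕ
    n = ∣ A ∣
    p = ∣ A +ˢ A ∣
    r = ∣ A ·ˢ A ∣
    M = n ⊔ℕ (p ⊔ℕ r)
    Z = ∣ (A -ˢ A) ∖R* ∣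
    0<n : 0 <ℕ n
    0<n = nonempty A A≢[]
    0<M : 0 <ℕ M
    0<M = ℕ.≤-trans 0<n (ℕ.m≤m⊔n n (p ⊔ℕ r))
    M≤Kn : fromℕ M ≤ᴿ K *ᴿ fromℕ n
    M≤Kn = ⊔-elim (λ k → fromℕ k ≤ᴿ K *ᴿ fromℕ n) n (p ⊔ℕ r) (self≤scaled {K} 0<n 1≤K)
      (⊔-elim (λ k → fromℕ k ≤ᴿ K *ᴿ fromℕ n) p r sums≤ products≤)

lemma1p7 :
  (em : ∀ {a} → ExcludedMiddle a) →
  ∃⁺ λ C → ∃⁺ λ C₁ → ∃⁺ λ C₂ →
  ∀ {c ℓ} (R : RingWithoutOne c ℓ) →
  let open RingWithoutOne R using (Carrier)
      open FiniteSubsets em R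
  in
  (A : List Carrier) (K : ℝ) →
  A ≢ [] →
  All R* A →
  fromℕ 1 ≤ᴿ K →
  fromℕ ∣ A +ˢ A ∣ ≤ᴿ K *ᴿ fromℕ ∣ A ∣ →
  fromℕ ∣ A ·ˢ A ∣ ≤ᴿ K *ᴿ fromℕ ∣ A ∣ →
  (fromℕ ∣ A ∣ ≤ᴿ fromℕ C *ᴿ K ^ᴿ C *ᴿ fromℕ ∣ (A -ˢ A) ∖R* ∣)
  ⊎
  (∃[ A′ ] A′ ⊆ A
         × (fromℕ ∣ A ∣ ≤ᴿ fromℕ 2 *ᴿ K *ᴿ fromℕ ∣ A′ ∣)
         × (fromℕ ∣ A′ ·ˢ A′ -ˢ A′ ·ˢ A′ ∣
              ≤ᴿ fromℕ C₁ *ᴿ K ^ᴿ C₂ *ᴿ fromℕ ∣ A′ ∣))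
lemma1p7 em = mk∃⁺ 32 (s≤s z≤n) (mk∃⁺ 524288 (s≤s z≤n) (mk∃⁺ 43 (s≤s z≤n) (Assembly.katz-tao em)))
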